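{- Let $m,r,s$ be positive integers with $m>3$ and $r\not\equiv 0\pmod{2m}$. If the graph $\Gamma=\Gamma_{12}(m,r,s)$ is connected and vertex-transitive, then $m$ is odd and $\Gamma\cong\mathrm{SDW}(m,3)$. Conversely, if $m$ is odd, then $\mathrm{SDW}(m,3)$ is isomorphic to $\Gamma_{12}(m,1,2)$, is connected and vertex-transitive, and admits an automorphism of order $2m$.
   Context: For a positive integer $m$ and integers $r,s$ with $r\not\equiv0\pmod{2m}$, $\Gamma_{12}(m,r,s)$ is the graph on $6m$ vertices with vertex set $\{u_i,v_i: i\in\mathbb{Z}_{2m}\}\cup\{a_i,b_i: i\in\mathbb{Z}_m\}$ and edges $\{u_i,v_i\}$, $\{u_i,v_{i+r}\}$, $\{u_i,a_{i\bmod m}\}$, $\{v_i,b_{i\bmod m}\}$ for $i\in\mathbb{Z}_{2m}$, and $\{a_i,b_{i+s}\}$ for $i\in\mathbb{Z}_m$. For $m,t\ge3$, $\mathrm{SDW}(m,t)$ is the graph with vertex set $\mathbb{Z}_m\times\mathbb{Z}_t\times\mathbb{Z}_2$ and edges $\{(x,i,0),(x,i\pm1,1)\}$ and $\{(x,i,1),(x+1,i,0)\}$ for $x\in\mathbb{Z}_m$, $i\in\mathbb{Z}_t$. -}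

module Defs where

open import Level using (0ℓ)
open import Data.Nat using (ℕ; zero; suc; _+_; _*_; _∸_; NonZero)
open import Data.Nat.DivMod using (_mod_)
open import Data.Fin using (Fin; toℕ)
open import Data.Product using (Σ; _×_; _,_)
open import Data.Sum using (_⊎_)
open import Function.Bundles using (_↔_; _⇔_; Inverse)
open import Relation.Binary.PropositionalEquality using (_≡_)
open import Relation.Binary.Construct.Closure.ReflexiveTransitive using (Star)

record Graph : Set₁ where
  field
    V   : Set
    Adj : V → V → Set
open Graph public

undirected : (V : Set) → (V → V → Set) → Graph
undirected V E = record { V = V ; Adj = λ x y → E x y ⊎ E y x }

_⊕_ : ∀ {n} → Fin n → ℕ → Fin n
_⊕_ {suc n} i k = (toℕ i + k) mod (suc n)

data VΓ (m : ℕ) : Set where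
  u v : Fin (2 * m) → VΓ m
  a b : Fin m → VΓ m

data EΓ (m r s : ℕ) .{{_ : NonZero m}} : VΓ m → VΓ m → Set where
  e-uv  : ∀ i → EΓ m r s (u i) (v i)
  e-uvr : ∀ i → EΓ m r s (u i) (v (i ⊕ r))
  e-ua  : ∀ i → EΓ m r s (u i) (a (toℕ i mod m))
  e-vb  : ∀ i → EΓ m r s (v i) (b (toℕ i mod m))
  e-ab  : ∀ i → EΓ m r s (a i) (b (i ⊕ s))

Γ₁₂ : (m r s : ℕ) .{{_ : NonZero m}} → Graph
Γ₁₂ m r s = undirected (VΓ m) (EΓ m r s)

VSDW : ℕ → ℕ → Set
VSDW m t = Fin m × Fin t × Fin 2

data ESDW (m t : ℕ) : VSDW m t → VSDW m t → Set where
  e-plus  : ∀ x i → ESDW m t (x , i , Fin.zero) (x , i ⊕ 1 , Fin.suc Fin.zero)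
  e-minus : ∀ x i → ESDW m t (x , i , Fin.zero) (x , i ⊕ (t ∸ 1) , Fin.suc Fin.zero)
  e-next  : ∀ x i → ESDW m t (x , i , Fin.suc Fin.zero) (x ⊕ 1 , i , Fin.zero)

SDW : ℕ → ℕ → Graph
SDW m t = undirected (VSDW m t) (ESDW m t)

record _≅_ (G H : Graph) : Set where
  field
    bij      : V G ↔ V H
    preserve : ∀ x y → Adj G x y ⇔ Adj H (Inverse.to bij x) (Inverse.to bij y)
open _≅_ public

Aut : Graph → Set
Aut G = G ≅ G

apply : ∀ {G H} → G ≅ H → V G → V H
apply φ = Inverse.to (bij φ)

Connected : Graph → Set
Connected G = ∀ x y → Star (Adj G) x y

VertexTransitive : Graph → Set
VertexTransitive G = ∀ x y → Σ (Aut G) λ φ → apply φ x ≡ y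

iter : {A : Set} → ℕ → (A → A) → A → A
iter zero    f x = x
iter (suc k) f x = f (iter k f x)

HasOrder : ∀ {G} → Aut G → ℕ → Set
HasOrder {G} φ n =
  (∀ x → iter n (apply φ) x ≡ x) ×
  (∀ k → 0 Data.Nat.< k → k Data.Nat.< n → Σ (V G) λ x → ¬' (iter k (apply φ) x ≡ x))
  where
    open import Relation.Nullary using () renaming (¬_ to ¬')

{-# OPTIONS --safe #-}
-- Γ₁₂(m,r,s) contains the m hexagons u_i v_i b_i v_{i+m} u_{i+m} a_i and as many with v_{i+r} in place
-- of v_i, so every edge at a vertex u_i lies on a hexagon. Vertex-transitivity then puts the edges
-- a_i b_{i+s} on hexagons as well, which happens only if s ≡ −r or s ≡ 2r (mod m); shifting the labels
-- of the v_i and b_i by r exchanges the two cases. If s ≡ −r, the first m hexagons are layers, and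
-- alternating the remaining edges with the antipodal pairs of the layers yields strands that advance by
-- q = r + m from layer to layer. After m steps the a,b-strand closes up, while the two u,v-strands
-- close up if q is even and are interchanged if q is odd. For m > 3 automorphisms respect strands
-- (count hexagons through paths of length two), so q is even; as q is invertible modulo m by
-- connectedness, m is odd, and the untwisted graph is SDW(m,3).

module Submission where

open import Defs
open import Data.Nat using (ℕ; zero; suc; _+_; _*_; pred; _<_; _≤_; s≤s; z≤n; NonZero; _%_; _/_)
open import Data.Nat.Properties
open import Data.Nat.DivMod using (_mod_; m%n<n; [m+kn]%n≡m%n; m≡m%n+[m/n]*n; m<n⇒m%n≡m)
open import Data.Nat.Divisibility using (_∣_; divides; ∣m+n∣m⇒∣n; ∣⇒≤; *-cancelʳ-∣; ∣m∣n⇒∣m+n; ∣n⇒∣m*n)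
open import Data.Nat.Tactic.RingSolver using (solve-∀)
open import Data.Fin using (Fin; toℕ)
open import Data.Fin.Patterns using (0F; 1F; 2F)
import Data.Fin.Properties as Fin
open import Data.Product using (_×_; Σ; ∃; _,_; proj₁; proj₂)
import Data.Product as Product
open import Data.Sum using (_⊎_; inj₁; inj₂; [_,_]′; swap)
import Data.Sum as Sum
open import Data.Sum.Properties using (inj₂-injective)
open import Data.Empty using (⊥; ⊥-elim)
open import Function using (_∘_; id)
open import Function.Bundles using (Inverse; Equivalence; mk⇔; mk↔ₛ′)
open import Relation.Nullary using (¬_; Dec; yes; no)
open import Relation.Binary.PropositionalEquality
open import Relation.Binary.Construct.Closure.ReflexiveTransitive using (Star; ε; _◅_; _◅◅_; gmap; reverse)

-- Congruences

infix 4 _≈_[_]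

-- Both sides carry a multiple of the modulus, so that no subtraction occurs.
record _≈_[_] (i j n : ℕ) : Set where
  constructor congruent
  field
    k l   : ℕ
    proof : i + k * n ≡ j + l * n

module _ {n : ℕ} where

  ≈-reflexive : ∀ {i j} → i ≡ j → i ≈ j [ n ]
  ≈-reflexive e = congruent 0 0 (cong (_+ 0) e)

  ≈-refl : ∀ {i} → i ≈ i [ n ]
  ≈-refl = ≈-reflexive refl

  ≈-sym : ∀ {i j} → i ≈ j [ n ] → j ≈ i [ n ]
  ≈-sym (congruent k l e) = congruent l k (sym e)

  +-cong-≈ : ∀ {i j i′ j′} → i ≈ j [ n ] → i′ ≈ j′ [ n ] → i + i′ ≈ j + j′ [ n ]
  +-cong-≈ {i} {j} {i′} {j′} (congruent k l e) (congruent k′ l′ e′) = congruent (k + k′) (l + l′)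
    (trans (shuffle i i′ k k′ n) (trans (cong₂ _+_ e e′) (sym (shuffle j j′ l l′ n))))
    where
    shuffle : ∀ i i′ k k′ n → i + i′ + (k + k′) * n ≡ (i + k * n) + (i′ + k′ * n)
    shuffle = solve-∀

  +-cancelʳ-≈ : ∀ {i j} c → i + c ≈ j + c [ n ] → i ≈ j [ n ]
  +-cancelʳ-≈ {i} {j} c (congruent k l e) = congruent k l
    (+-cancelʳ-≡ c _ _ (trans (shuffle i k n c) (trans e (sym (shuffle j l n c)))))
    where
    shuffle : ∀ i k n c → i + k * n + c ≡ i + c + k * n
    shuffle = solve-∀

  +-cancelˡ-≈ : ∀ {i j} c → c + i ≈ c + j [ n ] → i ≈ j [ n ]
  +-cancelˡ-≈ {i} {j} c e = +-cancelʳ-≈ c (subst₂ (_≈_[ n ]) (+-comm c i) (+-comm c j) e)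

  ≈-trans : ∀ {i j k} → i ≈ j [ n ] → j ≈ k [ n ] → i ≈ k [ n ]
  ≈-trans {i} {j} {k} p q =
    +-cancelʳ-≈ j (subst (i + j ≈_[ n ]) (+-comm j k) (+-cong-≈ p q))

  *-congˡ-≈ : ∀ c {i j} → i ≈ j [ n ] → c * i ≈ c * j [ n ]
  *-congˡ-≈ c {i} {j} (congruent k l e) = congruent (c * k) (c * l)
    (trans (shuffle c i k n) (trans (cong (c *_) e) (sym (shuffle c j l n))))
    where
    shuffle : ∀ c i k n → c * i + c * k * n ≡ c * (i + k * n)
    shuffle = solve-∀

  multiple≈0 : ∀ c → c * n ≈ 0 [ n ]
  multiple≈0 c = congruent 0 c (+-identityʳ (c * n))

  ≈-weaken : ∀ c {i j} → i ≈ j [ c * n ] → i ≈ j [ n ]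
  ≈-weaken c {i} {j} (congruent k l e) = congruent (k * c) (l * c)
    (trans (cong (i +_) (*-assoc k c n)) (trans e (cong (j +_) (sym (*-assoc l c n)))))

  ≈0⇒∣ : ∀ {i} → i ≈ 0 [ n ] → n ∣ i
  ≈0⇒∣ {i} (congruent k l e) =
    ∣m+n∣m⇒∣n (divides l (trans (+-comm (k * n) i) e)) (divides k refl)

  ≈0⇒≥ : ∀ {i} → 0 < i → i ≈ 0 [ n ] → n ≤ i
  ≈0⇒≥ {suc _} _ e = ∣⇒≤ (≈0⇒∣ e)

  module _ .{{_ : NonZero n}} where

    %-≈ : ∀ i → i % n ≈ i [ n ]
    %-≈ i = congruent (i / n) 0 (trans (sym (m≡m%n+[m/n]*n i n)) (sym (+-identityʳ i)))

    ≈⇒% : ∀ {i j} → i ≈ j [ n ] → i % n ≡ j % n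
    ≈⇒% {i} {j} (congruent k l e) =
      trans (sym ([m+kn]%n≡m%n i k n)) (trans (cong (_% n) e) ([m+kn]%n≡m%n j l n))

    mod-≈ : ∀ i → toℕ (i mod n) ≈ i [ n ]
    mod-≈ i = ≈-trans (≈-reflexive (Fin.toℕ-fromℕ< (m%n<n i n))) (%-≈ i)

    toℕ-injective-≈ : {i j : Fin n} → toℕ i ≈ toℕ j [ n ] → i ≡ j
    toℕ-injective-≈ {i} {j} e = Fin.toℕ-injective
      (trans (sym (m<n⇒m%n≡m (Fin.toℕ<n i))) (trans (≈⇒% e) (m<n⇒m%n≡m (Fin.toℕ<n j))))

    mod-injective : ∀ {i j} → i mod n ≡ j mod n → i ≈ j [ n ]
    mod-injective {i} {j} e =
      ≈-trans (≈-sym (mod-≈ i)) (≈-trans (≈-reflexive (cong toℕ e)) (mod-≈ j))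

toℕ-⊕ : ∀ {n} (i : Fin n) k → toℕ (i ⊕ k) ≈ toℕ i + k [ n ]
toℕ-⊕ {suc n} i k = mod-≈ (toℕ i + k)

toℕ≈⇒≡ : ∀ {n} {i j : Fin n} → toℕ i ≈ toℕ j [ n ] → i ≡ j
toℕ≈⇒≡ {suc n} = toℕ-injective-≈

module _ {n : ℕ} where

  ⊕-congʳ : ∀ (i : Fin n) {c d} → c ≈ d [ n ] → i ⊕ c ≡ i ⊕ d
  ⊕-congʳ i {c} {d} e =
    toℕ≈⇒≡ (≈-trans (toℕ-⊕ i c) (≈-trans (+-cong-≈ (≈-refl {i = toℕ i}) e) (≈-sym (toℕ-⊕ i d))))

  ⊕-≈0 : ∀ (i : Fin n) {c} → c ≈ 0 [ n ] → i ⊕ c ≡ i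
  ⊕-≈0 i {c} e = toℕ≈⇒≡ (≈-trans (toℕ-⊕ i c)
    (≈-trans (+-cong-≈ (≈-refl {i = toℕ i}) e) (≈-reflexive (+-identityʳ (toℕ i)))))

  ⊕-⊕ : ∀ (i : Fin n) c d → (i ⊕ c) ⊕ d ≡ i ⊕ (c + d)
  ⊕-⊕ i c d = toℕ≈⇒≡ (≈-trans (toℕ-⊕ (i ⊕ c) d)
    (≈-trans (+-cong-≈ (toℕ-⊕ i c) (≈-refl {i = d}))
    (≈-trans (≈-reflexive (+-assoc (toℕ i) c d)) (≈-sym (toℕ-⊕ i (c + d))))))

  ⊕-cancelˡ : ∀ (i : Fin n) {c d} → i ⊕ c ≡ i ⊕ d → c ≈ d [ n ]
  ⊕-cancelˡ i {c} {d} e = +-cancelˡ-≈ (toℕ i)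
    (≈-trans (≈-sym (toℕ-⊕ i c)) (≈-trans (≈-reflexive (cong toℕ e)) (toℕ-⊕ i d)))

  ⊕-fixed : ∀ (i : Fin n) {c} → i ⊕ c ≡ i → c ≈ 0 [ n ]
  ⊕-fixed i e = ⊕-cancelˡ i (trans e (sym (⊕-≈0 i ≈-refl)))

  ⊕-cancelʳ : ∀ {i j : Fin n} c → i ⊕ c ≡ j ⊕ c → i ≡ j
  ⊕-cancelʳ {i} {j} c e = toℕ≈⇒≡ (+-cancelʳ-≈ c
    (≈-trans (≈-sym (toℕ-⊕ i c)) (≈-trans (≈-reflexive (cong toℕ e)) (toℕ-⊕ j c))))

  ⊕-inverse : ∀ (i : Fin n) {c d} → c + d ≈ 0 [ n ] → (i ⊕ c) ⊕ d ≡ i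
  ⊕-inverse i {c} {d} e = trans (⊕-⊕ i c d) (⊕-≈0 i e)

even⊎odd : ∀ k → ∃ λ c → k ≡ c * 2 ⊎ k ≡ suc (c * 2)
even⊎odd zero = 0 , inj₁ refl
even⊎odd (suc k) with even⊎odd k
... | c , inj₁ e = c , inj₂ (cong suc e)
... | c , inj₂ e = suc c , inj₁ (cong suc e)

-- A residue modulo m has two lifts modulo 2m. Which of them occurs depends on whether the multiples
-- of m on the two sides have the same parity.
≈-lift : ∀ {m i j} → i ≈ j [ m ] → i ≈ j [ 2 * m ] ⊎ i ≈ j + m [ 2 * m ]
≈-lift {m} {i} {j} (congruent k l e) with even⊎odd k | even⊎odd l
... | c , inj₁ refl | d , inj₁ refl = inj₁ (congruent c d
      (trans (even i c m) (trans e (sym (even j d m)))))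
  where
  even : ∀ i c m → i + c * (2 * m) ≡ i + c * 2 * m
  even = solve-∀
... | c , inj₁ refl | d , inj₂ refl = inj₂ (congruent c d
      (trans (even i c m) (trans e (sym (odd j d m)))))
  where
  even : ∀ i c m → i + c * (2 * m) ≡ i + c * 2 * m
  even = solve-∀
  odd : ∀ i c m → i + m + c * (2 * m) ≡ i + suc (c * 2) * m
  odd = solve-∀
-- Adding m to both sides makes the odd multiple on the left even and puts the m next to `j`.
... | c , inj₂ refl | d , inj₁ refl = inj₂ (congruent (suc c) d
      (trans (odd i c m) (trans (cong (_+ m) e) (sym (even j d m)))))
  where
  even : ∀ i c m → i + m + c * (2 * m) ≡ i + c * 2 * m + m
  even = solve-∀
  odd : ∀ i c m → i + suc c * (2 * m) ≡ i + suc (c * 2) * m + m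
  odd = solve-∀
... | c , inj₂ refl | d , inj₂ refl = inj₁ (+-cancelʳ-≈ m (congruent c d
      (trans (odd i c m) (trans e (sym (odd j d m))))))
  where
  odd : ∀ i c m → i + m + c * (2 * m) ≡ i + suc (c * 2) * m
  odd = solve-∀

m≉0[2m] : ∀ {m} .{{_ : NonZero m}} → ¬ (m ≈ 0 [ 2 * m ])
m≉0[2m] {suc m} e = <⇒≱ (m<n+m (suc m) (s≤s z≤n)) (subst (_≤ suc m) (cong (suc m +_) (+-identityʳ (suc m))) (≈0⇒≥ (s≤s z≤n) e))

-- Isomorphisms

mk≅ : ∀ {G H} (f : V G → V H) (g : V H → V G) → (∀ y → f (g y) ≡ y) → (∀ x → g (f x) ≡ x) →
      (∀ {x y} → Adj G x y → Adj H (f x) (f y)) → (∀ {x y} → Adj H x y → Adj G (g x) (g y)) → G ≅ H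
mk≅ {G} f g fg gf f-adj g-adj = record
  { bij      = mk↔ₛ′ f g fg gf
  ; preserve = λ x y → mk⇔ f-adj (λ e → subst₂ (Adj G) (gf x) (gf y) (g-adj e))
  }

module _ {G H : Graph} (φ : G ≅ H) where

  unapply : V H → V G
  unapply = Inverse.from (bij φ)

  apply-unapply : ∀ y → apply φ (unapply y) ≡ y
  apply-unapply y = Inverse.inverseˡ (bij φ) refl

  unapply-apply : ∀ x → unapply (apply φ x) ≡ x
  unapply-apply x = Inverse.inverseʳ (bij φ) refl

  apply-injective : ∀ {x y} → apply φ x ≡ apply φ y → x ≡ y
  apply-injective {x} {y} e = trans (sym (unapply-apply x)) (trans (cong unapply e) (unapply-apply y))

  apply-adj : ∀ {x y} → Adj G x y → Adj H (apply φ x) (apply φ y)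
  apply-adj {x} {y} = Equivalence.to (preserve φ x y)

  unapply-adj : ∀ {x y} → Adj H x y → Adj G (unapply x) (unapply y)
  unapply-adj {x} {y} e = Equivalence.from (preserve φ (unapply x) (unapply y))
    (subst₂ (Adj H) (sym (apply-unapply x)) (sym (apply-unapply y)) e)

  ≅-sym : H ≅ G
  ≅-sym = mk≅ unapply (apply φ) unapply-apply apply-unapply unapply-adj apply-adj

≅-trans : ∀ {G H K} → G ≅ H → H ≅ K → G ≅ K
≅-trans φ ψ = mk≅ (apply ψ ∘ apply φ) (unapply φ ∘ unapply ψ)
  (λ z → trans (cong (apply ψ) (apply-unapply φ _)) (apply-unapply ψ z))
  (λ x → trans (cong (unapply φ) (unapply-apply ψ _)) (unapply-apply φ x))
  (apply-adj ψ ∘ apply-adj φ) (unapply-adj φ ∘ unapply-adj ψ)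

connected-resp-≅ : ∀ {G H} → G ≅ H → Connected G → Connected H
connected-resp-≅ {G} {H} φ conn x y = subst₂ (Star (Adj H)) (apply-unapply φ x) (apply-unapply φ y)
  (gmap (apply φ) (apply-adj φ) (conn (unapply φ x) (unapply φ y)))

transitive-resp-≅ : ∀ {G H} → G ≅ H → VertexTransitive G → VertexTransitive H
transitive-resp-≅ φ vt x y with vt (unapply φ x) (unapply φ y)
... | α , e = ≅-trans (≅-sym φ) (≅-trans α φ) , trans (cong (apply φ) e) (apply-unapply φ y)

transitive-from-base : ∀ {G} (x₀ : V G) → (∀ y → Σ (Aut G) λ φ → apply φ x₀ ≡ y) → VertexTransitive G
transitive-from-base x₀ move x y with move x | move y
... | α , refl | β , refl = ≅-trans (≅-sym α) β , cong (apply β) (unapply-apply α x₀)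

connected-from-base : ∀ {G} → (∀ {x y} → Adj G x y → Adj G y x) →
                      (x₀ : V G) → (∀ y → Star (Adj G) x₀ y) → Connected G
connected-from-base sym-adj x₀ path x y = reverse sym-adj (path x) ◅◅ path y

-- Strand graphs

-- A point of X stands for a pair of vertices. In a layer of three points, `Hexagonal` yields
-- K_{3,3} minus a perfect matching, a hexagon in which `inlet x` and `outlet x` are antipodal.
-- Alternating such pairs with the edges from `outlet x` to `inlet (θ x)` traces a strand.
data Port (X : Set) : Set where
  inlet outlet : X → Port X

module _ {X L : Set} (layer : X → L) (θ : X → X) where

  Hexagonal Link : X → X → Set
  Hexagonal x y = layer x ≡ layer y × x ≢ y
  Link x y = Hexagonal x y ⊎ y ≡ θ x

  StrandAdj : Port X → Port X → Set
  StrandAdj (outlet x) (inlet y)  = Link x y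
  StrandAdj (inlet y)  (outlet x) = Link x y
  StrandAdj (inlet _)  (inlet _)  = ⊥
  StrandAdj (outlet _) (outlet _) = ⊥

  Strand : Graph
  Strand = record { V = Port X ; Adj = StrandAdj }

  strandAdj-sym : ∀ p q → StrandAdj p q → StrandAdj q p
  strandAdj-sym (outlet _) (inlet _) e = e
  strandAdj-sym (inlet _) (outlet _) e = e

Port-map : ∀ {X Y : Set} → (X → Y) → Port X → Port Y
Port-map f (inlet x)  = inlet (f x)
Port-map f (outlet x) = outlet (f x)

Strand-≅ : ∀ {X L Y K : Set} {layer : X → L} {θ : X → X} {layer′ : Y → K} {θ′ : Y → Y}
  (f : X → Y) (g : Y → X) → (∀ y → f (g y) ≡ y) → (∀ x → g (f x) ≡ x) →
  (∀ x → f (θ x) ≡ θ′ (f x)) →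
  (∀ {x y} → layer x ≡ layer y → layer′ (f x) ≡ layer′ (f y)) →
  (∀ {x y} → layer′ (f x) ≡ layer′ (f y) → layer x ≡ layer y) →
  Strand layer θ ≅ Strand layer′ θ′
Strand-≅ {layer = layer} {θ} {layer′} {θ′} f g fg gf f-θ f-layer f-layer⁻ =
  mk≅ (Port-map f) (Port-map g)
    (λ { (inlet y) → cong inlet (fg y) ; (outlet y) → cong outlet (fg y) })
    (λ { (inlet x) → cong inlet (gf x) ; (outlet x) → cong outlet (gf x) })
    (λ {p} {q} → to p q) (λ {p} {q} → from p q)
  where
  f-injective : ∀ {x y} → f x ≡ f y → x ≡ y
  f-injective {x} {y} e = trans (sym (gf x)) (trans (cong g e) (gf y))
  link : ∀ x y → Link layer θ x y → Link layer′ θ′ (f x) (f y)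
  link x y (inj₁ (e , ne)) = inj₁ (f-layer e , ne ∘ f-injective)
  link x y (inj₂ refl)     = inj₂ (f-θ x)
  link⁻ : ∀ x y → Link layer′ θ′ x y → Link layer θ (g x) (g y)
  link⁻ x y (inj₁ (e , ne)) = inj₁
    ( f-layer⁻ (trans (cong layer′ (fg x)) (trans e (cong layer′ (sym (fg y)))))
    , λ gx≡gy → ne (trans (sym (fg x)) (trans (cong f gx≡gy) (fg y))))
  link⁻ x y (inj₂ refl) = inj₂ (f-injective
    (trans (fg _) (trans (cong θ′ (sym (fg x))) (sym (f-θ (g x))))))
  to : ∀ p q → StrandAdj layer θ p q → StrandAdj layer′ θ′ (Port-map f p) (Port-map f q)
  to (outlet x) (inlet y) = link x y
  to (inlet y) (outlet x) = link x y
  from : ∀ p q → StrandAdj layer′ θ′ p q → StrandAdj layer θ (Port-map g p) (Port-map g q)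
  from (outlet x) (inlet y) = link⁻ x y
  from (inlet y) (outlet x) = link⁻ x y

-- The aim is that an automorphism taking one outlet to an outlet carries the whole strand along. By
-- `partners` every layer is a hexagon; `free₁` to `free₃` keep a strand from returning to its layer
-- within three steps, which is what `3 < m` will provide.
module Rigidity {X L : Set} (layer : X → L) (θ θ⁻ : X → X)
  (θθ⁻ : ∀ x → θ (θ⁻ x) ≡ x) (θ⁻θ : ∀ x → θ⁻ (θ x) ≡ x)
  (θ-layer  : ∀ {x y} → layer x ≡ layer y → layer (θ x) ≡ layer (θ y))
  (θ⁻-layer : ∀ {x y} → layer x ≡ layer y → layer (θ⁻ x) ≡ layer (θ⁻ y))
  (free₁ : ∀ x → layer (θ x) ≢ layer x)
  (free₂ : ∀ x → layer (θ (θ x)) ≢ layer x)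
  (free₃ : ∀ x → layer (θ (θ (θ x))) ≢ layer x)
  (partners : ∀ x → ∃ λ y → ∃ λ z →
     (layer y ≡ layer x × layer z ≡ layer x × y ≢ x × z ≢ x × y ≢ z) ×
     (∀ w → layer w ≡ layer x → w ≡ x ⊎ w ≡ y ⊎ w ≡ z))
  where

  G : Graph
  G = Strand layer θ

  θ⁻-injective : ∀ {x y} → θ⁻ x ≡ θ⁻ y → x ≡ y
  θ⁻-injective {x} {y} e = trans (sym (θθ⁻ x)) (trans (cong θ e) (θθ⁻ y))

  θ-injective : ∀ {x y} → θ x ≡ θ y → x ≡ y
  θ-injective {x} {y} e = trans (sym (θ⁻θ x)) (trans (cong θ⁻ e) (θ⁻θ y))

  -- Pigeonhole: y, z and w all lie among the two partners of x, and y and z already occupy both.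
  third : ∀ {x y z w} → layer y ≡ layer x → layer z ≡ layer x → layer w ≡ layer x →
          y ≢ x → z ≢ x → y ≢ z → w ≢ x → w ≢ y → w ≡ z
  third {x} {y} {z} {w} ly lz lw y≢x z≢x y≢z w≢x w≢y with partners x
  ... | y′ , z′ , _ , cover with cover y ly | cover z lz | cover w lw
  ... | inj₁ e | _ | _ = ⊥-elim (y≢x e)
  ... | inj₂ _ | inj₁ e | _ = ⊥-elim (z≢x e)
  ... | inj₂ _ | inj₂ _ | inj₁ e = ⊥-elim (w≢x e)
  ... | inj₂ (inj₁ p) | inj₂ (inj₁ q) | inj₂ _ = ⊥-elim (y≢z (trans p (sym q)))
  ... | inj₂ (inj₂ p) | inj₂ (inj₂ q) | inj₂ _ = ⊥-elim (y≢z (trans p (sym q)))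
  ... | inj₂ (inj₁ p) | inj₂ (inj₂ q) | inj₂ (inj₁ t) = ⊥-elim (w≢y (trans t (sym p)))
  ... | inj₂ (inj₂ p) | inj₂ (inj₁ q) | inj₂ (inj₂ t) = ⊥-elim (w≢y (trans t (sym p)))
  ... | inj₂ (inj₁ p) | inj₂ (inj₂ q) | inj₂ (inj₂ t) = trans t (sym q)
  ... | inj₂ (inj₂ p) | inj₂ (inj₁ q) | inj₂ (inj₁ t) = trans t (sym q)

  outlet-neighbour : ∀ {x} w → Adj G (outlet x) w → ∃ λ y → w ≡ inlet y × Link layer θ x y
  outlet-neighbour (inlet y) e = y , refl , e

  inlet-neighbour : ∀ {y} w → Adj G (inlet y) w → ∃ λ x → w ≡ outlet x × Link layer θ x y
  inlet-neighbour (outlet x) e = x , refl , e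

  outlet-injective : ∀ {x y : X} → outlet x ≡ outlet y → x ≡ y
  outlet-injective refl = refl

  inlet-injective : ∀ {x y : X} → inlet x ≡ inlet y → x ≡ y
  inlet-injective refl = refl

  -- Every further edge at inlet z lies on a hexagon through inlet y – outlet x – inlet z; by no-hexagon
  -- below, this singles out the θ-edge at outlet x, so automorphisms preserve it.
  hexagons : ∀ {x y z} → Hexagonal layer θ x y → Hexagonal layer θ x z → y ≢ z →
    ∀ p → Link layer θ p z → p ≢ x → ∃ λ p′ → ∃ λ w →
      Link layer θ p′ y × p′ ≢ x × Link layer θ p′ w × Link layer θ p w
  hexagons {x} {y} {z} (xy , x≢y) (xz , x≢z) y≢z p (inj₁ (pz , p≢z)) p≢x
    with third (sym xz) (sym xy) (trans pz (sym xz)) (x≢z ∘ sym) (x≢y ∘ sym) (y≢z ∘ sym) p≢x p≢z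
  ... | refl = z , x , inj₁ (sym pz , p≢z ∘ sym) , x≢z ∘ sym ,
               inj₁ (sym xz , x≢z ∘ sym) , inj₁ (sym xy , p≢x)
  -- This hexagon straddles two layers: it descends from `inlet y` and `inlet z` along their strands
  -- and closes up through `inlet (θ⁻ x)`.
  hexagons {x} {y} {z} (xy , x≢y) (xz , x≢z) y≢z p (inj₂ refl) p≢x =
    θ⁻ y , θ⁻ x , inj₂ (sym (θθ⁻ y))
    , (λ e → free₁ x (trans (cong (layer ∘ θ) (sym e)) (trans (cong layer (θθ⁻ y)) (sym xy))))
    , inj₁ (θ⁻-layer (sym xy) , λ e → x≢y (sym (θ⁻-injective e)))
    , inj₁ ( trans (cong layer (sym (θ⁻θ p))) (θ⁻-layer (sym xz))
           , λ e → x≢z (sym (trans (cong θ e) (θθ⁻ x))))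

  -- The analogue of hexagons fails with θ x in place of y: w would lie one or two layers above x,
  -- but also in the layer of x or one below it.
  no-hexagon : ∀ {x z p′ w} → Link layer θ p′ (θ x) → p′ ≢ x → Link layer θ p′ w →
               layer z ≡ layer x → ¬ Link layer θ (θ⁻ z) w
  no-hexagon {x} {z} {p′} {w} (inj₂ e) p′≢x = λ _ _ _ → p′≢x (sym (θ-injective e))
  no-hexagon {x} {z} {p′} {w} (inj₁ (e , _)) p′≢x (inj₁ (f , _)) lz (inj₁ (g , _)) =
    free₂ (θ⁻ x) (trans (cong (layer ∘ θ) (θθ⁻ x)) (trans (sym e) (trans f (trans (sym g) (θ⁻-layer lz)))))
  no-hexagon {x} {z} {p′} {w} (inj₁ (e , _)) p′≢x (inj₁ (f , _)) lz (inj₂ g) =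
    free₁ x (trans (sym e) (trans f (trans (cong layer (trans g (θθ⁻ z))) lz)))
  no-hexagon {x} {z} {p′} {w} (inj₁ (e , _)) p′≢x (inj₂ refl) lz (inj₁ (g , _)) =
    free₃ (θ⁻ x) (trans (cong (layer ∘ θ ∘ θ) (θθ⁻ x))
      (trans (θ-layer (sym e)) (trans (sym g) (θ⁻-layer lz))))
  no-hexagon {x} {z} {p′} {w} (inj₁ (e , _)) p′≢x (inj₂ refl) lz (inj₂ g) =
    free₂ x (trans (θ-layer (sym e)) (trans (cong layer (trans g (θθ⁻ z))) lz))

  another-hexagonal : ∀ {x y} → Hexagonal layer θ x y → ∃ λ z → Hexagonal layer θ x z × y ≢ z
  another-hexagonal {x} {y} (xy , x≢y) with partners x
  ... | p , q , (lp , lq , p≢x , q≢x , p≢q) , cover with cover y (sym xy)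
  ... | inj₁ e = ⊥-elim (x≢y (sym e))
  ... | inj₂ (inj₁ refl) = q , (sym lq , q≢x ∘ sym) , p≢q
  ... | inj₂ (inj₂ refl) = p , (sym lp , p≢x ∘ sym) , p≢q ∘ sym

  -- An outlet with a θ-edge into the layer lies in another layer by `free₁`, so its hexagonal edges
  -- miss the other inlet. Within the layer only the third point is left.
  common-neighbour : ∀ {c y z p} → Hexagonal layer θ c y → Hexagonal layer θ c z → y ≢ z →
                     Link layer θ p y → Link layer θ p z → p ≡ c
  common-neighbour (cy , c≢y) (cz , c≢z) y≢z (inj₁ (py , p≢y)) (inj₁ (_ , p≢z)) =
    third (trans (sym cz) cy) cy py (y≢z ∘ sym) c≢y (c≢z ∘ sym) p≢y p≢z
  common-neighbour (cy , _) (cz , _) _ (inj₁ (py , _)) (inj₂ refl) =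
    ⊥-elim (free₁ _ (trans (sym cz) (trans cy (sym py))))
  common-neighbour (cy , _) (cz , _) _ (inj₂ refl) (inj₁ (pz , _)) =
    ⊥-elim (free₁ _ (trans (sym cy) (trans cz (sym pz))))
  common-neighbour _ _ y≢z (inj₂ e) (inj₂ e′) = ⊥-elim (y≢z (trans e (sym e′)))

  module _ (φ : Aut G) where

    private
      f  = apply φ
      f⁻ = unapply φ

    inlet-image : ∀ {x x′ y} → f (outlet x) ≡ outlet x′ → Link layer θ x y →
                  ∃ λ y′ → f (inlet y) ≡ inlet y′ × Link layer θ x′ y′
    inlet-image {x} {x′} {y} fx xy = outlet-neighbour (f (inlet y))
      (subst (λ p → Adj G p (f (inlet y))) fx (apply-adj φ {outlet x} {inlet y} xy))

    outlet-image : ∀ {y y′ x} → f (inlet y) ≡ inlet y′ → Link layer θ x y →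
                   ∃ λ x′ → f (outlet x) ≡ outlet x′ × Link layer θ x′ y′
    outlet-image {y} {y′} {x} fy xy = inlet-neighbour (f (outlet x))
      (subst (λ p → Adj G p (f (outlet x))) fy (apply-adj φ {inlet y} {outlet x} xy))

    inlet-preimage : ∀ {x x′ y′} → f (outlet x) ≡ outlet x′ → Link layer θ x′ y′ →
                     ∃ λ y → f (inlet y) ≡ inlet y′ × Link layer θ x y
    inlet-preimage {x} {x′} {y′} fx xy′
      with outlet-neighbour (f⁻ (inlet y′))
             (subst (λ p → Adj G p (f⁻ (inlet y′))) (trans (cong f⁻ (sym fx)) (unapply-apply φ _))
               (unapply-adj φ {outlet x′} {inlet y′} xy′))
    ... | y , e , xy = y , trans (cong f (sym e)) (apply-unapply φ _) , xy

    outlet-preimage : ∀ {y y′ x′} → f (inlet y) ≡ inlet y′ → Link layer θ x′ y′ →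
                      ∃ λ x → f (outlet x) ≡ outlet x′ × Link layer θ x y
    outlet-preimage {y} {y′} {x′} fy xy′
      with inlet-neighbour (f⁻ (outlet x′))
             (subst (λ p → Adj G p (f⁻ (outlet x′))) (trans (cong f⁻ (sym fy)) (unapply-apply φ _))
               (unapply-adj φ {inlet y′} {outlet x′} xy′))
    ... | x , e , xy = x , trans (cong f (sym e)) (apply-unapply φ _) , xy

    link-image : ∀ {x x′ y y′} → f (outlet x) ≡ outlet x′ → f (inlet y) ≡ inlet y′ →
                 Link layer θ x y → Link layer θ x′ y′
    link-image {x} {y = y} fx fy xy = subst₂ (Adj G) fx fy (apply-adj φ {outlet x} {inlet y} xy)

    f-≡ : ∀ {p q p′ q′} → f p ≡ p′ → f q ≡ q′ → p′ ≡ q′ → p ≡ q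
    f-≡ fp fq e = apply-injective φ (trans fp (trans e (sym fq)))

    -- Suppose that `inlet (θ x′)` is the image of a hexagonal neighbour `inlet y` of `outlet x`,
    -- and let z be the third point of the layer. The path from `inlet y` over `outlet x` to
    -- `inlet z` extends to a hexagon through any further edge at `inlet z`, but its image does not.
    next-image : ∀ {x x′} → f (outlet x) ≡ outlet x′ → f (inlet (θ x)) ≡ inlet (θ x′)
    next-image {x} {x′} fx with inlet-preimage fx (inj₂ refl)
    ... | y , fy , inj₂ refl = fy
    ... | y , fy , inj₁ xy with another-hexagonal xy
    ... | z , xz , y≢z with inlet-image fx (inj₁ xz)
    ... | z′ , fz , inj₂ refl = ⊥-elim (y≢z (inlet-injective (f-≡ fy fz refl)))
    -- Take for p the outlet whose edge to `inlet z` is carried to the θ-edge at `inlet z′`; this is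
    -- the edge that `no-hexagon` speaks about.
    ... | z′ , fz , inj₁ (xz′ , _) with outlet-preimage fz (inj₂ (sym (θθ⁻ z′)))
    ... | p , fp , pz
      with hexagons xy xz y≢z p pz
             (λ p≡x → free₁ (θ⁻ z′) (trans (cong layer (θθ⁻ z′)) (trans (sym xz′)
               (cong layer (outlet-injective (trans (sym fx) (trans (cong (f ∘ outlet) (sym p≡x)) fp)))))))
    ... | p₁ , w , p₁y , p₁≢x , p₁w , pw with inlet-image fp pw | outlet-image fy p₁y
    ... | w′ , fw , pw′ | p₁′ , fp₁ , p₁y′ = ⊥-elim
      (no-hexagon p₁y′ (λ e → p₁≢x (outlet-injective (f-≡ fp₁ fx (cong outlet e))))
        (link-image fp₁ fw p₁w) (sym xz′) pw′)

    -- The neighbours of `inlet (θ x)` are `outlet x` and its hexagonal neighbours. By `next-image`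
    -- the images of `inlet (θ x)` and `outlet x` are known, so hexagonal neighbours must go to
    -- hexagonal neighbours.
    hexagonal-outlet-image : ∀ {x x′ y} → f (outlet x) ≡ outlet x′ → Hexagonal layer θ (θ x) y →
                             ∃ λ y′ → f (outlet y) ≡ outlet y′ × Hexagonal layer θ (θ x′) y′
    hexagonal-outlet-image {x} {x′} {y} fx (xy , x≢y)
      with outlet-image (next-image fx) (inj₁ (sym xy , x≢y ∘ sym))
    ... | y′ , fy , inj₁ (e , ne) = y′ , fy , sym e , ne ∘ sym
    ... | y′ , fy , inj₂ e = ⊥-elim (free₁ x (trans xy
            (cong layer (outlet-injective (f-≡ fy fx (cong outlet (sym (θ-injective e))))))))

    -- Here c, y, z are the three points of a layer. The image of `inlet z` is a neighbour of
    -- `outlet y′`; it is not `inlet (θ y′)`, which is the image of `inlet (θ y)`, and it is not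
    -- `inlet c′`, so only `inlet z′` remains.
    hexagonal-inlet-image : ∀ {c c′ y y′ z z′} → f (inlet c) ≡ inlet c′ →
      f (outlet y) ≡ outlet y′ → f (outlet z) ≡ outlet z′ →
      Hexagonal layer θ c y → Hexagonal layer θ c z → y ≢ z →
      Hexagonal layer θ c′ y′ → Hexagonal layer θ c′ z′ → y′ ≢ z′ →
      f (inlet z) ≡ inlet z′
    hexagonal-inlet-image fc fy fz (cy , c≢y) (cz , c≢z) y≢z (cy′ , c≢y′) (cz′ , c≢z′) y≢z′
      with inlet-image fy (inj₁ (trans (sym cy) cz , y≢z))
    ... | w , fz₁ , inj₂ refl = ⊥-elim (free₁ _ (trans (cong layer (sym (inlet-injective
            (f-≡ fz₁ (next-image fy) refl)))) (trans (sym cz) cy)))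
    ... | w , fz₁ , inj₁ (yw , y≢w) = trans fz₁ (cong inlet
            (third (sym cy′) (sym cz′) (trans (sym yw) (sym cy′)) (c≢y′ ∘ sym) (c≢z′ ∘ sym) y≢z′
              (λ e → c≢z (inlet-injective (f-≡ fc fz₁ (cong inlet (sym e))))) (y≢w ∘ sym)))

    -- In its hexagon, `outlet (θ x)` is the common neighbour of the inlets of the other two points
    -- y and z. Once the images of these inlets are known, `common-neighbour` determines its image.
    opposite-image : ∀ {x x′} → f (outlet x) ≡ outlet x′ → f (outlet (θ x)) ≡ outlet (θ x′)
    opposite-image {x} {x′} fx with partners (θ x)
    ... | y , z , (ly , lz , y≢ , z≢ , y≢z) , _
      with hexagonal-outlet-image fx (sym ly , y≢ ∘ sym) | hexagonal-outlet-image fx (sym lz , z≢ ∘ sym)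
    ... | y′ , fy , hy′ | z′ , fz , hz′ = result
      where
      hy : Hexagonal layer θ (θ x) y
      hy = sym ly , y≢ ∘ sym
      hz : Hexagonal layer θ (θ x) z
      hz = sym lz , z≢ ∘ sym
      y′≢z′ : y′ ≢ z′
      y′≢z′ e = y≢z (outlet-injective (f-≡ fy fz (cong outlet e)))
      fiy : f (inlet y) ≡ inlet y′
      fiy = hexagonal-inlet-image (next-image fx) fz fy hz hy (y≢z ∘ sym) hz′ hy′ (y′≢z′ ∘ sym)
      fiz : f (inlet z) ≡ inlet z′
      fiz = hexagonal-inlet-image (next-image fx) fy fz hy hz y≢z hy′ hz′ y′≢z′
      result : f (outlet (θ x)) ≡ outlet (θ x′)
      result with outlet-image fiy (inj₁ hy)
      ... | p , fp , py = trans fp (cong outlet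
            (common-neighbour hy′ hz′ y′≢z′ py (link-image fp fiz (inj₁ hz))))

    iterated-image : ∀ k {x x′} → f (outlet x) ≡ outlet x′ → f (outlet (iter k θ x)) ≡ outlet (iter k θ x′)
    iterated-image zero    fx = fx
    iterated-image (suc k) fx = opposite-image (iterated-image k fx)

    -- The closing length of a strand is therefore an invariant; it will separate the a,b-strand
    -- from twisted u,v-strands.
    period-image : ∀ k {x x′} → f (outlet x) ≡ outlet x′ → iter k θ x ≡ x → iter k θ x′ ≡ x′
    period-image k fx e = outlet-injective
      (trans (sym (iterated-image k fx)) (trans (cong (f ∘ outlet) e) fx))

-- The graphs Γ₁₂ as strand graphs

module _ {m : ℕ} .{{_ : NonZero m}} where

  red : Fin (2 * m) → Fin m
  red i = toℕ i mod m

  red-⊕ : ∀ i c → red (i ⊕ c) ≡ red i ⊕ c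
  red-⊕ i c = toℕ≈⇒≡ (≈-trans (mod-≈ (toℕ (i ⊕ c))) (≈-trans (≈-weaken 2 (toℕ-⊕ i c))
    (≈-trans (+-cong-≈ (≈-sym (mod-≈ (toℕ i))) (≈-refl {i = c})) (≈-sym (toℕ-⊕ (red i) c)))))

  red-⊕m : ∀ i → red (i ⊕ m) ≡ red i
  red-⊕m i = trans (red-⊕ i m) (⊕-≈0 (red i) (≈-trans (≈-reflexive (sym (+-identityʳ m))) (multiple≈0 1)))

  ⊕m-involutive : ∀ (i : Fin (2 * m)) → (i ⊕ m) ⊕ m ≡ i
  ⊕m-involutive i = ⊕-inverse i (≈-trans (≈-reflexive (m+m≡1*[2*m] m)) (multiple≈0 1))
    where
    m+m≡1*[2*m] : ∀ m → m + m ≡ 1 * (2 * m)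
    m+m≡1*[2*m] = solve-∀

  ⊕m-free : ∀ (i : Fin (2 * m)) → i ⊕ m ≢ i
  ⊕m-free i e = m≉0[2m] (⊕-fixed i e)

  red-injective-≈ : ∀ i j → red i ≡ red j → toℕ i ≈ toℕ j [ m ]
  red-injective-≈ i j = mod-injective {i = toℕ i} {toℕ j}

  red-fibre : ∀ {i j} → red i ≡ red j → j ≢ i → j ≡ i ⊕ m
  red-fibre {i} {j} e j≢i = [ (λ p → ⊥-elim (j≢i (toℕ≈⇒≡ p))) , (λ p → toℕ≈⇒≡ (≈-trans p (≈-sym (toℕ-⊕ i m)))) ]′
    (≈-lift (≈-sym (red-injective-≈ i j e)))

  -- `inj₁ i` is the antipodal pair a_i, b_i and `inj₂ i` the antipodal pair v_i, u_{i+m} of the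
  -- hexagon u_i v_i b_i v_{i+m} u_{i+m} a_i.
  Pos : Set
  Pos = Fin m ⊎ Fin (2 * m)

  layer : Pos → Fin m
  layer = [ id , red ]′

  turn : ℕ → Pos → Pos
  turn q = Sum.map (_⊕ q) (_⊕ q)

  -- The edge from u_i to v_{i+r} leads from position i + m to i + r, an advance of r + m modulo 2m.
  -- The edge from b_{i+s} to a_i advances by -s, which agrees with r + m modulo m by hypothesis.
  Γ₁₂-≅-Strand : ∀ {r s} → s + r ≈ 0 [ m ] → Γ₁₂ m r s ≅ Strand layer (turn (r + m))
  Γ₁₂-≅-Strand {r} {s} s+r≈0 = mk≅ to from to-from from-to
    [ to-edge , strandAdj-sym layer (turn q) _ _ ∘ to-edge ]′ (λ {x} {y} → from-adj x y)
    where
    q = r + m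

    -- Shifted by m since u_{i+m} is antipodal to v_i in its hexagon.
    to : VΓ m → Port Pos
    to (u i) = outlet (inj₂ (i ⊕ m))
    to (v i) = inlet (inj₂ i)
    to (a i) = inlet (inj₁ i)
    to (b i) = outlet (inj₁ i)

    from : Port Pos → VΓ m
    from (outlet (inj₂ i)) = u (i ⊕ m)
    from (inlet (inj₂ i))  = v i
    from (inlet (inj₁ i))  = a i
    from (outlet (inj₁ i)) = b i

    to-from : ∀ p → to (from p) ≡ p
    to-from (outlet (inj₂ i)) = cong (outlet ∘ inj₂) (⊕m-involutive i)
    to-from (inlet (inj₂ i))  = refl
    to-from (inlet (inj₁ i))  = refl
    to-from (outlet (inj₁ i)) = refl

    from-to : ∀ x → from (to x) ≡ x
    from-to (u i) = cong u (⊕m-involutive i)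
    from-to (v i) = refl
    from-to (a i) = refl
    from-to (b i) = refl

    ⊕q : ∀ (i : Fin (2 * m)) → i ⊕ q ≡ (i ⊕ m) ⊕ r
    ⊕q i = trans (cong (i ⊕_) (+-comm r m)) (sym (⊕-⊕ i m r))

    q≈r : q ≈ r [ m ]
    q≈r = congruent 0 1 (trans (+-identityʳ q) (cong (r +_) (sym (+-identityʳ m))))

    s+q≈0 : s + q ≈ 0 [ m ]
    s+q≈0 = ≈-trans (+-cong-≈ (≈-refl {i = s}) q≈r) s+r≈0

    to-edge : ∀ {x y} → EΓ m r s x y → StrandAdj layer (turn q) (to x) (to y)
    to-edge (e-uv i)  = inj₁ (red-⊕m i , ⊕m-free i ∘ inj₂-injective)
    to-edge (e-uvr i) = inj₂ (cong inj₂ (sym (trans (⊕q (i ⊕ m)) (cong (_⊕ r) (⊕m-involutive i)))))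
    to-edge (e-ua i)  = inj₁ (red-⊕m i , λ ())
    to-edge (e-vb i)  = inj₁ (refl , λ ())
    to-edge (e-ab i)  = inj₂ (cong inj₁ (sym (⊕-inverse i s+q≈0)))

    from-link : ∀ x y → Link layer (turn q) x y → EΓ m r s (from (outlet x)) (from (inlet y)) ⊎
                                                  EΓ m r s (from (inlet y)) (from (outlet x))
    from-link (inj₁ i) (inj₁ j) (inj₁ (e , ne)) = ⊥-elim (ne (cong inj₁ e))
    from-link (inj₁ i) (inj₁ _) (inj₂ refl) = inj₂ (subst (EΓ m r s _) (cong b
      (⊕-inverse i (≈-trans (≈-reflexive (+-comm q s)) s+q≈0))) (e-ab (i ⊕ q)))
    from-link (inj₁ _) (inj₂ j) (inj₁ (refl , _)) = inj₂ (e-vb j)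
    from-link (inj₁ _) (inj₂ j) (inj₂ ())
    from-link (inj₂ i) (inj₁ _) (inj₁ (refl , _)) = inj₁ (subst (EΓ m r s _) (cong a (red-⊕m i)) (e-ua (i ⊕ m)))
    from-link (inj₂ i) (inj₁ _) (inj₂ ())
    from-link (inj₂ i) (inj₂ j) (inj₁ (e , ne)) =
      inj₁ (subst (EΓ m r s _) (cong v (sym (red-fibre e (ne ∘ cong inj₂ ∘ sym)))) (e-uv (i ⊕ m)))
    from-link (inj₂ i) (inj₂ _) (inj₂ refl) =
      inj₁ (subst (EΓ m r s _) (cong v (sym (⊕q i))) (e-uvr (i ⊕ m)))

    from-adj : ∀ p p′ → StrandAdj layer (turn q) p p′ → Adj (Γ₁₂ m r s) (from p) (from p′)
    from-adj (outlet x) (inlet y) e = from-link x y e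
    from-adj (inlet y) (outlet x) e = swap (from-link x y e)

  -- Shifting the labels of the v_i and b_i by r′, that is by -r, exchanges the edges `e-uv` with
  -- the edges `e-uvr` and adds r′ to s.
  Γ₁₂-reflect : ∀ {r r′ s s′} → r + r′ ≈ 0 [ 2 * m ] → s + r′ ≈ s′ [ m ] → Γ₁₂ m r s ≅ Γ₁₂ m r′ s′
  Γ₁₂-reflect {r} {r′} {s} {s′} r+r′≈0 s+r′≈s′ = mk≅ (to r′) (to r)
    (to-to r+r′≈0) (to-to r′+r≈0)
    [ to-edge r+r′≈0 s+r′≈s′ , swap ∘ to-edge r+r′≈0 s+r′≈s′ ]′
    [ to-edge r′+r≈0 s′+r≈s , swap ∘ to-edge r′+r≈0 s′+r≈s ]′
    where
    r′+r≈0 : r′ + r ≈ 0 [ 2 * m ]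
    r′+r≈0 = ≈-trans (≈-reflexive (+-comm r′ r)) r+r′≈0

    s′+r≈s : s′ + r ≈ s [ m ]
    s′+r≈s = ≈-trans (+-cong-≈ (≈-sym s+r′≈s′) (≈-refl {i = r})) (≈-trans (≈-reflexive (+-assoc s r′ r))
      (≈-trans (+-cong-≈ (≈-refl {i = s}) (≈-weaken 2 r′+r≈0)) (≈-reflexive (+-identityʳ s))))

    to : ℕ → VΓ m → VΓ m
    to c (u i) = u i
    to c (v i) = v (i ⊕ c)
    to c (a i) = a i
    to c (b i) = b (i ⊕ c)

    to-to : ∀ {c d} → c + d ≈ 0 [ 2 * m ] → ∀ x → to d (to c x) ≡ x
    to-to e (u i) = refl
    to-to e (v i) = cong v (⊕-inverse i e)
    to-to e (a i) = refl
    to-to e (b i) = cong b (⊕-inverse i (≈-weaken 2 e))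

    to-edge : ∀ {r r′ s s′} → r + r′ ≈ 0 [ 2 * m ] → s + r′ ≈ s′ [ m ] →
              ∀ {x y} → EΓ m r s x y → Adj (Γ₁₂ m r′ s′) (to r′ x) (to r′ y)
    to-edge {r′ = r′} e e′ (e-uv i) = inj₁ (e-uvr i)
    to-edge {r′ = r′} e e′ (e-uvr i) = inj₁ (subst (EΓ m _ _ (u i)) (cong v (sym (⊕-inverse i e))) (e-uv i))
    to-edge e e′ (e-ua i) = inj₁ (e-ua i)
    to-edge {r′ = r′} e e′ (e-vb i) = inj₁ (subst (EΓ m _ _ _) (cong b (red-⊕ i r′)) (e-vb (i ⊕ r′)))
    to-edge {r′ = r′} {s = s} e e′ (e-ab i) = inj₁ (subst (EΓ m _ _ _)
      (cong b (trans (⊕-congʳ i (≈-sym e′)) (sym (⊕-⊕ i s r′)))) (e-ab i))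

-- Closed walks of length six

-- Non-backtracking, but not necessarily a cycle.
record HexWalk (G : Graph) (x y : V G) : Set where
  constructor hexWalk
  field
    {p q r s} : V G
    y~p : Adj G y p
    p~q : Adj G p q
    q~r : Adj G q r
    r~s : Adj G r s
    s~x : Adj G s x
    x≢p : x ≢ p
    y≢q : y ≢ q
    p≢r : p ≢ r
    q≢s : q ≢ s
    r≢x : r ≢ x
    s≢y : s ≢ y

hexWalk-image : ∀ {G H} (φ : G ≅ H) {x y} → HexWalk G x y → HexWalk H (apply φ x) (apply φ y)
hexWalk-image φ (hexWalk e₁ e₂ e₃ e₄ e₅ n₁ n₂ n₃ n₄ n₅ n₆) =
  hexWalk (apply-adj φ e₁) (apply-adj φ e₂) (apply-adj φ e₃) (apply-adj φ e₄) (apply-adj φ e₅)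
          (n₁ ∘ inj) (n₂ ∘ inj) (n₃ ∘ inj) (n₄ ∘ inj) (n₅ ∘ inj) (n₆ ∘ inj)
  where
  inj : ∀ {x y} → apply φ x ≡ apply φ y → x ≡ y
  inj = apply-injective φ

module _ {m r s : ℕ} .{{_ : NonZero m}} where

  u-injective : ∀ {i j : Fin (2 * m)} → u {m} i ≡ u j → i ≡ j
  u-injective refl = refl

  v-injective : ∀ {i j : Fin (2 * m)} → v {m} i ≡ v j → i ≡ j
  v-injective refl = refl

  -- The edges `e-uv` and `e-ua` at u_i share the hexagon of the layer; `e-uvr` lies on the hexagon
  -- in which v_{i+r} and v_{i+r+m} replace v_i and v_{i+m}.
  u-hexWalk : ∀ {i y} → Adj (Γ₁₂ m r s) (u i) y → HexWalk (Γ₁₂ m r s) (u i) y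
  u-hexWalk (inj₁ (e-uv i)) = hexWalk {p = b (red i)} {v (i ⊕ m)} {u (i ⊕ m)} {a (red i)}
    (inj₁ (e-vb i))
    (inj₂ (subst (EΓ m r s _) (cong b (red-⊕m i)) (e-vb (i ⊕ m))))
    (inj₂ (e-uv (i ⊕ m)))
    (inj₁ (subst (EΓ m r s _) (cong a (red-⊕m i)) (e-ua (i ⊕ m))))
    (inj₂ (e-ua i))
    (λ ()) (⊕m-free i ∘ sym ∘ v-injective) (λ ()) (λ ()) (⊕m-free i ∘ u-injective) (λ ())
  u-hexWalk (inj₁ (e-uvr i)) = hexWalk {p = b (red (i ⊕ r))} {v ((i ⊕ r) ⊕ m)} {u (i ⊕ m)} {a (red i)}
    (inj₁ (e-vb (i ⊕ r)))
    (inj₂ (subst (EΓ m r s _) (cong b (red-⊕m (i ⊕ r))) (e-vb ((i ⊕ r) ⊕ m))))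
    (inj₂ (subst (EΓ m r s _) (cong v (trans (⊕-⊕ i m r) (trans (cong (i ⊕_) (+-comm m r)) (sym (⊕-⊕ i r m)))))
      (e-uvr (i ⊕ m))))
    (inj₁ (subst (EΓ m r s _) (cong a (red-⊕m i)) (e-ua (i ⊕ m))))
    (inj₂ (e-ua i))
    (λ ()) (⊕m-free (i ⊕ r) ∘ sym ∘ v-injective) (λ ()) (λ ()) (⊕m-free i ∘ u-injective) (λ ())
  u-hexWalk (inj₁ (e-ua i)) = hexWalk {p = u (i ⊕ m)} {v (i ⊕ m)} {b (red i)} {v i}
    (inj₂ (subst (EΓ m r s _) (cong a (red-⊕m i)) (e-ua (i ⊕ m))))
    (inj₁ (e-uv (i ⊕ m)))
    (inj₁ (subst (EΓ m r s _) (cong b (red-⊕m i)) (e-vb (i ⊕ m))))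
    (inj₂ (e-vb i))
    (inj₂ (e-uv i))
    (⊕m-free i ∘ sym ∘ u-injective) (λ ()) (λ ()) (⊕m-free i ∘ v-injective) (λ ()) (λ ())

  a-neighbour : ∀ {i} y → Adj (Γ₁₂ m r s) (a i) y → y ≡ b (i ⊕ s) ⊎ ∃ λ j → y ≡ u j × red j ≡ i
  a-neighbour _ (inj₁ (e-ab i)) = inj₁ refl
  a-neighbour _ (inj₂ (e-ua j)) = inj₂ (j , refl , refl)

  b-neighbour : ∀ {i} y → Adj (Γ₁₂ m r s) (b i) y → (∃ λ j → y ≡ a j × j ⊕ s ≡ i) ⊎ ∃ λ j → y ≡ v j × red j ≡ i
  b-neighbour _ (inj₂ (e-ab i)) = inj₁ (i , refl , refl)
  b-neighbour _ (inj₂ (e-vb j)) = inj₂ (j , refl , refl)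

  u-neighbour : ∀ {i} y → Adj (Γ₁₂ m r s) (u i) y → y ≡ a (red i) ⊎ y ≡ v i ⊎ y ≡ v (i ⊕ r)
  u-neighbour _ (inj₁ (e-uv i))  = inj₂ (inj₁ refl)
  u-neighbour _ (inj₁ (e-uvr i)) = inj₂ (inj₂ refl)
  u-neighbour _ (inj₁ (e-ua i))  = inj₁ refl

  v-neighbour : ∀ {i} y → Adj (Γ₁₂ m r s) (v i) y → y ≡ b (red i) ⊎ ∃ λ j → y ≡ u j × (i ≡ j ⊎ i ≡ j ⊕ r)
  v-neighbour _ (inj₂ (e-uv i))  = inj₂ (i , refl , inj₁ refl)
  v-neighbour _ (inj₂ (e-uvr i)) = inj₂ (i , refl , inj₂ refl)
  v-neighbour _ (inj₁ (e-vb i))  = inj₁ refl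

  -- Absence of backtracking forces the walk to run from b_{i+s} through some v_j, u, v, u_k back to
  -- a_i, with `e-uv` and `e-uvr` alternating on the three middle edges. Two edges `e-uv` around one
  -- `e-uvr` give k = j + r, and the opposite pattern gives j = k + 2r. Reducing modulo m turns j
  -- into i + s and k into i.
  ab-hexWalk : ∀ {i} → HexWalk (Γ₁₂ m r s) (a i) (b (i ⊕ s)) → s + r ≈ 0 [ m ] ⊎ s ≈ r + r [ m ]
  ab-hexWalk {i} (hexWalk {s = w} y~p p~q q~r r~s s~x x≢p y≢q p≢r q≢s r≢x s≢y)
    with b-neighbour _ y~p | a-neighbour w (swap s~x)
  ... | inj₁ (j , refl , e) | _ = ⊥-elim (x≢p (cong a (sym (⊕-cancelʳ s e))))
  ... | inj₂ _ | inj₁ e = ⊥-elim (s≢y e)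
  ... | inj₂ (j , refl , ej) | inj₂ (k , refl , ek)
    with v-neighbour _ p~q | u-neighbour _ (swap r~s)
  ... | inj₁ refl | _ = ⊥-elim (y≢q (cong b (sym ej)))
  ... | inj₂ _ | inj₁ refl = ⊥-elim (r≢x (cong a ek))
  ... | inj₂ (j′ , refl , ej′) | inj₂ ek′ with u-neighbour _ q~r
  ab-hexWalk {i} _ | _ | _ | inj₂ (_ , refl , _) | inj₂ (inj₁ ()) | inj₁ refl
  ab-hexWalk {i} _ | _ | _ | inj₂ (_ , refl , _) | inj₂ (inj₂ ()) | inj₁ refl
  ab-hexWalk {i} (hexWalk _ _ _ _ _ _ _ p≢r q≢s _ _) | inj₂ (j , refl , ej) | inj₂ (k , refl , ek)
    | inj₂ (j′ , refl , ej′) | inj₂ ek′ | inj₂ er with ej′ | er | ek′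
  ... | inj₁ refl | inj₁ refl | _ = ⊥-elim (p≢r refl)
  ... | inj₁ refl | inj₂ refl | inj₂ e = ⊥-elim (q≢s (cong u (⊕-cancelʳ r (v-injective e))))
  ... | inj₁ refl | inj₂ refl | inj₁ refl = inj₁ (⊕-fixed i (trans (sym (⊕-⊕ i s r))
        (trans (cong (_⊕ r) (sym ej)) (trans (sym (red-⊕ j r)) ek))))
  ... | inj₂ refl | inj₂ refl | _ = ⊥-elim (p≢r refl)
  ... | inj₂ refl | inj₁ refl | inj₁ refl = ⊥-elim (q≢s refl)
  ... | inj₂ refl | inj₁ refl | inj₂ refl = inj₂ (⊕-cancelˡ i (trans (sym ej)
        (trans (red-⊕ (k ⊕ r) r) (trans (cong (_⊕ r) (red-⊕ k r))
        (trans (⊕-⊕ (red k) r r) (cong (_⊕ (r + r)) ek))))))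

  -- An automorphism from u_0 to a_0 pulls the edge a_0 b_s back to some edge at u_0; which one does
  -- not matter, as `u-hexWalk` covers them all.
  transitive⇒s : VertexTransitive (Γ₁₂ m r s) → s + r ≈ 0 [ m ] ⊎ s ≈ r + r [ m ]
  transitive⇒s vt with vt (u (0 mod (2 * m))) (a (0 mod m))
    where instance _ = m*n≢0 2 m
  ... | φ , φu = ab-hexWalk (subst₂ (HexWalk _) φu (apply-unapply φ _)
    (hexWalk-image φ (u-hexWalk (subst (λ x → Adj (Γ₁₂ m r s) x (unapply φ (b ((0 mod m) ⊕ s))))
      (trans (cong (unapply φ) (sym φu)) (unapply-apply φ _)) (unapply-adj φ (inj₁ (e-ab (0 mod m))))))))

-- The product `pred n * i` serves as -i from here on.
negate-≈ : ∀ n .{{_ : NonZero n}} i → i + pred n * i ≈ 0 [ n ]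
negate-≈ n i = ≈-trans (≈-reflexive (trans (cong (_* i) (suc-pred n)) (*-comm n i))) (multiple≈0 i)

iter-⊕ : ∀ {n} k c (i : Fin n) → iter k (_⊕ c) i ≡ i ⊕ (k * c)
iter-⊕ zero    c i = sym (⊕-≈0 i ≈-refl)
iter-⊕ (suc k) c i = trans (cong (_⊕ c) (iter-⊕ k c i))
  (trans (⊕-⊕ i (k * c) c) (cong (i ⊕_) (+-comm (k * c) c)))

-- Consequences of connectedness and vertex-transitivity for the advance q

module _ {m : ℕ} .{{_ : NonZero m}} where

  private instance
    2m≢0 : NonZero (2 * m)
    2m≢0 = m*n≢0 2 m

  layer-turn : ∀ q x → layer (turn {m} q x) ≡ layer x ⊕ q
  layer-turn q (inj₁ i) = refl
  layer-turn q (inj₂ i) = red-⊕ i q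

  turn-turn : ∀ {c d} → c + d ≈ 0 [ 2 * m ] → ∀ x → turn {m} d (turn c x) ≡ x
  turn-turn e (inj₁ i) = cong inj₁ (⊕-inverse i (≈-weaken 2 e))
  turn-turn e (inj₂ i) = cong inj₂ (⊕-inverse i e)

  iter-turn₁ : ∀ q k i → iter k (turn {m} q) (inj₁ i) ≡ inj₁ (i ⊕ (k * q))
  iter-turn₁ q k i = trans (step k) (cong inj₁ (iter-⊕ k q i))
    where
    step : ∀ k → iter k (turn {m} q) (inj₁ i) ≡ inj₁ (iter k (_⊕ q) i)
    step zero    = refl
    step (suc k) = cong (turn q) (step k)

  iter-turn₂ : ∀ q k i → iter k (turn {m} q) (inj₂ i) ≡ inj₂ (i ⊕ (k * q))
  iter-turn₂ q k i = trans (step k) (cong inj₂ (iter-⊕ k q i))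
    where
    step : ∀ k → iter k (turn {m} q) (inj₂ i) ≡ inj₂ (iter k (_⊕ q) i)
    step zero    = refl
    step (suc k) = cong (turn q) (step k)

  toℕ-red : ∀ i → toℕ (red i) ≈ toℕ i [ m ]
  toℕ-red i = mod-≈ (toℕ i)

  section : Fin m → Fin (2 * m)
  section i = toℕ i mod (2 * m)

  red-section : ∀ i → red (section i) ≡ i
  red-section i = toℕ≈⇒≡ (≈-trans (toℕ-red (section i)) (≈-weaken 2 (mod-≈ (toℕ i))))

  layer-partners : ∀ x → ∃ λ y → ∃ λ z →
     (layer y ≡ layer x × layer z ≡ layer x × y ≢ x × z ≢ x × y ≢ z) ×
     (∀ w → layer w ≡ layer x → w ≡ x ⊎ w ≡ y ⊎ w ≡ z)
  layer-partners (inj₁ i) = inj₂ j , inj₂ (j ⊕ m)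
    , (red-section i , trans (red-⊕m j) (red-section i) , (λ ()) , (λ ()) , ⊕m-free j ∘ sym ∘ inj₂-injective)
    , λ { (inj₁ k) e → inj₁ (cong inj₁ e) ; (inj₂ k) e → inj₂ (cover k (k Fin.≟ j) e) }
    where
    j = section i
    cover : ∀ k → Dec (k ≡ j) → red k ≡ i → inj₂ k ≡ inj₂ j ⊎ inj₂ k ≡ inj₂ (j ⊕ m)
    cover k (yes p) e = inj₁ (cong inj₂ p)
    cover k (no ¬p) e = inj₂ (cong inj₂ (red-fibre (trans (red-section i) (sym e)) ¬p))
  layer-partners (inj₂ i) = inj₁ (red i) , inj₂ (i ⊕ m)
    , (refl , red-⊕m i , (λ ()) , ⊕m-free i ∘ inj₂-injective , (λ ()))
    , λ { (inj₁ k) e → inj₂ (inj₁ (cong inj₁ e)) ; (inj₂ k) e → cover k (k Fin.≟ i) e }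
    where
    cover : ∀ k → Dec (k ≡ i) → red k ≡ red i → inj₂ k ≡ inj₂ i ⊎ inj₂ k ≡ inj₁ (red i) ⊎ inj₂ k ≡ inj₂ (i ⊕ m)
    cover k (yes p) e = inj₁ (cong inj₂ p)
    cover k (no ¬p) e = inj₂ (inj₂ (cong inj₂ (red-fibre (sym e) ¬p)))

  -- An edge stays in its layer or changes the layer by q or -q. All layers reached from layer 0 are
  -- thus multiples of q, and layer 1 is among them.
  connected⇒unit : ∀ {q} → Connected (Strand layer (turn {m} q)) → ∃ λ t → t * q ≈ 1 [ m ]
  connected⇒unit {q} conn =
    conclude (walk (conn (inlet (inj₁ (0 mod m))) (inlet (inj₁ (1 mod m)))) (0 , mod-≈ 0))
    where
    position : Port Pos → Fin m
    position (inlet x)  = layer x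
    position (outlet x) = layer x

    Reached : Fin m → Set
    Reached i = ∃ λ n → toℕ i ≈ n * q [ m ]

    forward : ∀ {x y} → Link layer (turn q) x y → Reached (layer x) → Reached (layer y)
    forward (inj₁ (e , _)) (n , p) = n , ≈-trans (≈-reflexive (cong toℕ (sym e))) p
    forward {x} (inj₂ refl) (n , p) = suc n ,
      ≈-trans (≈-reflexive (cong toℕ (layer-turn q x))) (≈-trans (toℕ-⊕ (layer x) q)
      (≈-trans (+-cong-≈ p (≈-refl {i = q})) (≈-reflexive (+-comm (n * q) q))))

    backward : ∀ {x y} → Link layer (turn q) x y → Reached (layer y) → Reached (layer x)
    backward (inj₁ (e , _)) (n , p) = n , ≈-trans (≈-reflexive (cong toℕ e)) p
    -- A step back by q is m - 1 steps forward modulo m.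
    backward {x} (inj₂ refl) (n , p) = n + pred m , +-cancelʳ-≈ q
      (≈-trans (≈-sym (toℕ-⊕ (layer x) q)) (≈-trans (≈-reflexive (cong toℕ (sym (layer-turn q x))))
      (≈-trans p (≈-trans (≈-reflexive (sym (+-identityʳ (n * q))))
      (≈-trans (+-cong-≈ (≈-refl {i = n * q}) (≈-sym (negate-≈ m q))) (≈-reflexive (shuffle n q (pred m))))))))
      where
      shuffle : ∀ n q k → n * q + (q + k * q) ≡ (n + k) * q + q
      shuffle = solve-∀

    walk : ∀ {p p′} → Star (StrandAdj layer (turn q)) p p′ → Reached (position p) → Reached (position p′)
    walk ε h = h
    walk (_◅_ {outlet x} {inlet y} e es) h = walk es (forward {x} {y} e h)
    walk (_◅_ {inlet y} {outlet x} e es) h = walk es (backward {x} {y} e h)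

    conclude : Reached (1 mod m) → ∃ λ t → t * q ≈ 1 [ m ]
    conclude (t , e) = t , ≈-trans (≈-sym e) (mod-≈ 1)

  -- Some automorphism takes an outlet of the a,b-strand to one of a u,v-strand. The former closes
  -- up after m steps, since mq is 0 modulo m; so the latter does too, and 2m divides mq.
  transitive⇒2∣ : ∀ {q} t → t * q ≈ 1 [ m ] → 3 < m → VertexTransitive (Strand layer (turn {m} q)) → 2 ∣ q
  transitive⇒2∣ {q} t tq≈1 3<m vt =
    conclude (vt (outlet (inj₁ (0 mod m))) (outlet (inj₂ (0 mod (2 * m)))))
    where
    q⁻ = pred (2 * m) * q

    -- Multiplying kq ≈ 0 by the inverse t of q would give k ≈ 0 modulo m.
    free : ∀ k → 0 < k → k < m → ∀ (i : Fin m) → i ⊕ (k * q) ≢ i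
    free k 0<k k<m i e = <⇒≱ k<m (≈0⇒≥ 0<k (≈-trans k≈t*[kq]
      (≈-trans (*-congˡ-≈ t (⊕-fixed i e)) (≈-reflexive (*-zeroʳ t)))))
      where
      shuffle : ∀ k t q → k * (t * q) ≡ t * (k * q)
      shuffle = solve-∀
      k≈t*[kq] : k ≈ t * (k * q) [ m ]
      k≈t*[kq] = ≈-trans (≈-reflexive (sym (*-identityʳ k)))
        (≈-trans (*-congˡ-≈ k (≈-sym tq≈1)) (≈-reflexive (shuffle k t q)))

    layer-iter : ∀ k x → layer (iter k (turn {m} q) x) ≡ layer x ⊕ (k * q)
    layer-iter k (inj₁ i) = cong layer (iter-turn₁ q k i)
    layer-iter k (inj₂ i) = trans (cong layer (iter-turn₂ q k i)) (red-⊕ i (k * q))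

    free-turn : ∀ k → 0 < k → k < m → ∀ x → layer (iter k (turn {m} q) x) ≢ layer x
    free-turn k 0<k k<m x e = free k 0<k k<m (layer x) (trans (sym (layer-iter k x)) e)

    turn-layer : ∀ c {x y} → layer x ≡ layer y → layer (turn {m} c x) ≡ layer (turn c y)
    turn-layer c {x} {y} e = trans (layer-turn c x) (trans (cong (_⊕ c) e) (sym (layer-turn c y)))

    module R = Rigidity layer (turn q) (turn q⁻)
      (turn-turn (≈-trans (≈-reflexive (+-comm q⁻ q)) (negate-≈ (2 * m) q)))
      (turn-turn (negate-≈ (2 * m) q))
      (λ {x} {y} → turn-layer q {x} {y}) (λ {x} {y} → turn-layer q⁻ {x} {y})
      (free-turn 1 (s≤s z≤n) (≤-trans (s≤s (s≤s z≤n)) 3<m))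
      (free-turn 2 (s≤s z≤n) (≤-trans (s≤s (s≤s (s≤s z≤n))) 3<m))
      (free-turn 3 (s≤s z≤n) 3<m)
      layer-partners

    conclude : ∀ {i j} → (Σ (Aut R.G) λ φ → apply φ (outlet (inj₁ i)) ≡ outlet (inj₂ j)) → 2 ∣ q
    conclude {i} {j} (φ , e) = *-cancelʳ-∣ m (subst (2 * m ∣_) (*-comm m q) (≈0⇒∣ (⊕-fixed j
      (inj₂-injective (trans (sym (iter-turn₂ q m j)) (R.period-image φ m e
        (trans (iter-turn₁ q m i) (cong inj₁ (⊕-≈0 i
          (≈-trans (≈-reflexive (*-comm m q)) (multiple≈0 q)))))))))))

-- The graphs SDW(m,3)

module _ {m : ℕ} where

  next : Fin m × Fin 3 → Fin m × Fin 3
  next (x , i) = x ⊕ 1 , i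

  -- For t = 3 the indices i + 1 and i - 1 are exactly those other than i, so `e-plus` and `e-minus`
  -- form the hexagon of layer x, while `e-next` continues the strand i.
  Strand-≅-SDW : Strand proj₁ next ≅ SDW m 3
  Strand-≅-SDW = mk≅ to from to-from from-to (λ {p} {q} → to-adj p q)
    [ from-edge , strandAdj-sym proj₁ next _ _ ∘ from-edge ]′
    where
    to : Port (Fin m × Fin 3) → VSDW m 3
    to (inlet (x , i))  = x , i , 0F
    to (outlet (x , i)) = x , i , 1F

    from : VSDW m 3 → Port (Fin m × Fin 3)
    from (x , i , 0F) = inlet (x , i)
    from (x , i , 1F) = outlet (x , i)

    to-from : ∀ y → to (from y) ≡ y
    to-from (x , i , 0F) = refl
    to-from (x , i , 1F) = refl

    from-to : ∀ p → from (to p) ≡ p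
    from-to (inlet _)  = refl
    from-to (outlet _) = refl

    hexagon : ∀ x i j → (x , i) ≢ (x , j) → ESDW m 3 (x , j , 0F) (x , i , 1F)
    hexagon x 0F 0F ne = ⊥-elim (ne refl)
    hexagon x 0F 1F ne = e-minus x 1F
    hexagon x 0F 2F ne = e-plus x 2F
    hexagon x 1F 0F ne = e-plus x 0F
    hexagon x 1F 1F ne = ⊥-elim (ne refl)
    hexagon x 1F 2F ne = e-minus x 2F
    hexagon x 2F 0F ne = e-minus x 0F
    hexagon x 2F 1F ne = e-plus x 1F
    hexagon x 2F 2F ne = ⊥-elim (ne refl)

    to-link : ∀ z w → Link proj₁ next z w → Adj (SDW m 3) (to (outlet z)) (to (inlet w))
    to-link (x , i) (.x , j) (inj₁ (refl , ne)) = inj₂ (hexagon x i j ne)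
    to-link (x , i) _ (inj₂ refl) = inj₁ (e-next x i)

    to-adj : ∀ p q → StrandAdj proj₁ next p q → Adj (SDW m 3) (to p) (to q)
    to-adj (outlet z) (inlet w) e = to-link z w e
    to-adj (inlet w) (outlet z) e = swap (to-link z w e)

    ⊕1-free : ∀ (i : Fin 3) → i ⊕ 1 ≢ i
    ⊕1-free 0F ()
    ⊕1-free 1F ()
    ⊕1-free 2F ()

    ⊕2-free : ∀ (i : Fin 3) → i ⊕ 2 ≢ i
    ⊕2-free 0F ()
    ⊕2-free 1F ()
    ⊕2-free 2F ()

    from-edge : ∀ {y z} → ESDW m 3 y z → StrandAdj proj₁ next (from y) (from z)
    from-edge (e-plus x i)  = inj₁ (refl , ⊕1-free i ∘ cong proj₂)
    from-edge (e-minus x i) = inj₁ (refl , ⊕2-free i ∘ cong proj₂)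
    from-edge (e-next x i)  = inj₂ refl

  ⊕-swap : ∀ (x : Fin m) c d → (x ⊕ c) ⊕ d ≡ (x ⊕ d) ⊕ c
  ⊕-swap x c d = trans (⊕-⊕ x c d) (trans (cong (x ⊕_) (+-comm c d)) (sym (⊕-⊕ x d c)))

  -- Without a twist, the strands can be permuted by any σ, independently of the rotation of the
  -- layers.
  shift : ∀ c d → c + d ≈ 0 [ m ] → (σ σ⁻ : Fin 3 → Fin 3) → (∀ i → σ (σ⁻ i) ≡ i) → (∀ i → σ⁻ (σ i) ≡ i) →
          Aut (Strand (proj₁ {B = λ (_ : Fin m) → Fin 3}) next)
  shift c d c+d≈0 σ σ⁻ σσ⁻ σ⁻σ = Strand-≅ (λ (x , i) → x ⊕ c , σ i) (λ (x , i) → x ⊕ d , σ⁻ i)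
    (λ (x , i) → cong₂ _,_ (⊕-inverse x (≈-trans (≈-reflexive (+-comm d c)) c+d≈0)) (σσ⁻ i))
    (λ (x , i) → cong₂ _,_ (⊕-inverse x c+d≈0) (σ⁻σ i))
    (λ (x , i) → cong (_, σ i) (⊕-swap x 1 c))
    (cong (_⊕ c)) (⊕-cancelʳ c)

module _ {m : ℕ} .{{_ : NonZero m}} where

  private
    S : Graph
    S = Strand (proj₁ {B = λ (_ : Fin m) → Fin 3}) next

    origin : Fin m
    origin = 0 mod m

  origin-⊕ : ∀ x → origin ⊕ toℕ x ≡ x
  origin-⊕ x = toℕ≈⇒≡ (≈-trans (toℕ-⊕ origin (toℕ x)) (+-cong-≈ (mod-≈ 0) (≈-refl {i = toℕ x})))

  neg : Fin m → Fin m
  neg x = (pred m * toℕ x) mod m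

  neg-≈ : ∀ x → toℕ x + toℕ (neg x) ≈ 0 [ m ]
  neg-≈ x = ≈-trans (+-cong-≈ (≈-refl {i = toℕ x}) (mod-≈ (pred m * toℕ x))) (negate-≈ m (toℕ x))

  neg-unique : ∀ {x y : Fin m} → toℕ x + toℕ y ≈ 0 [ m ] → y ≡ neg x
  neg-unique {x} {y} e = toℕ≈⇒≡ (+-cancelˡ-≈ (toℕ x) (≈-trans e (≈-sym (neg-≈ x))))

  neg-involutive : ∀ x → neg (neg x) ≡ x
  neg-involutive x = sym (neg-unique (≈-trans (≈-reflexive (+-comm (toℕ (neg x)) (toℕ x))) (neg-≈ x)))

  neg-⊕1 : ∀ x → neg x ≡ neg (x ⊕ 1) ⊕ 1
  neg-⊕1 x = sym (neg-unique (≈-trans (+-cong-≈ (≈-refl {i = toℕ x}) (toℕ-⊕ (neg (x ⊕ 1)) 1))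
    (≈-trans (≈-reflexive (shuffle (toℕ x) (toℕ (neg (x ⊕ 1)))))
    (≈-trans (+-cong-≈ (≈-sym (toℕ-⊕ x 1)) (≈-refl {i = toℕ (neg (x ⊕ 1))})) (neg-≈ (x ⊕ 1))))))
    where
    shuffle : ∀ x y → x + (y + 1) ≡ (x + 1) + y
    shuffle = solve-∀

  -- Exchanging inlets with outlets reverses the direction of the strands; negating the layers
  -- compensates for this.
  flip : Aut S
  flip = mk≅ to to to-to to-to (λ {p} {q} → to-adj p q) (λ {p} {q} → to-adj p q)
    where
    ρ : Fin m × Fin 3 → Fin m × Fin 3
    ρ (x , i) = neg x , i

    ρρ : ∀ z → ρ (ρ z) ≡ z
    ρρ (x , i) = cong (_, i) (neg-involutive x)

    to : Port (Fin m × Fin 3) → Port (Fin m × Fin 3)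
    to (inlet z)  = outlet (ρ z)
    to (outlet z) = inlet (ρ z)

    to-to : ∀ p → to (to p) ≡ p
    to-to (inlet z)  = cong inlet (ρρ z)
    to-to (outlet z) = cong outlet (ρρ z)

    to-link : ∀ z w → Link proj₁ next z w → Link proj₁ next (ρ w) (ρ z)
    to-link z w (inj₁ (e , ne)) = inj₁ (cong neg (sym e) ,
      λ e′ → ne (trans (sym (ρρ z)) (trans (cong ρ (sym e′)) (ρρ w))))
    to-link (x , i) _ (inj₂ refl) = inj₂ (cong (_, i) (neg-⊕1 x))

    to-adj : ∀ p q → StrandAdj proj₁ next p q → StrandAdj proj₁ next (to p) (to q)
    to-adj (outlet z) (inlet w) e = to-link z w e
    to-adj (inlet w) (outlet z) e = to-link z w e

  SDW-transitive : VertexTransitive (SDW m 3)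
  SDW-transitive = transitive-resp-≅ Strand-≅-SDW (transitive-from-base (inlet (origin , 0F)) move)
    where
    to-inlet : ∀ x i → Σ (Aut S) λ φ → apply φ (inlet (origin , 0F)) ≡ inlet (x , i)
    to-inlet x i =
        -- Modulo 3, adding 2i undoes adding i.
        shift (toℕ x) (pred m * toℕ x) (negate-≈ m (toℕ x)) (_⊕ toℕ i) (_⊕ (2 * toℕ i))
          (λ j → ⊕-inverse j (≈-trans (≈-reflexive (+-comm (2 * toℕ i) (toℕ i))) (negate-≈ 3 (toℕ i))))
          (λ j → ⊕-inverse j (negate-≈ 3 (toℕ i)))
      , cong₂ (λ x i → inlet (x , i)) (origin-⊕ x) (toℕ-injective-≈ (mod-≈ (toℕ i)))

    move : ∀ p → Σ (Aut S) λ φ → apply φ (inlet (origin , 0F)) ≡ p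
    move (inlet (x , i))  = to-inlet x i
    -- The target layer is -x because `flip` negates it once more.
    move (outlet (x , i)) = via (to-inlet (neg x) i)
      where
      via : (Σ (Aut S) λ φ → apply φ (inlet (origin , 0F)) ≡ inlet (neg x , i)) →
            Σ (Aut S) λ φ → apply φ (inlet (origin , 0F)) ≡ outlet (x , i)
      via (φ , e) = ≅-trans φ flip ,
        trans (cong (apply flip) e) (cong (λ x → outlet (x , i)) (neg-involutive x))

  -- Climb along strand `0F` to the required layer, crossing each hexagon from inlet to outlet, and
  -- then walk within the last hexagon.
  SDW-connected : Connected (SDW m 3)
  SDW-connected = connected-resp-≅ Strand-≅-SDW
    (connected-from-base (λ {p} {q} → strandAdj-sym proj₁ next p q) (inlet (origin , 0F)) path)
    where
    edge : ∀ x i j → i ≢ j → Link proj₁ next (x , i) (x , j)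
    edge x i j ne = inj₁ (refl , ne ∘ cong proj₂)

    within-inlet : ∀ x i → Star (Adj S) (inlet (x , 0F)) (inlet (x , i))
    within-inlet x 0F = ε
    within-inlet x 1F = _◅_ {j = outlet (x , 2F)} (edge x 2F 0F λ ()) (edge x 2F 1F (λ ()) ◅ ε)
    within-inlet x 2F = _◅_ {j = outlet (x , 1F)} (edge x 1F 0F λ ()) (edge x 1F 2F (λ ()) ◅ ε)

    within-outlet : ∀ x i → Star (Adj S) (inlet (x , 0F)) (outlet (x , i))
    within-outlet x 0F = within-inlet x 1F ◅◅ edge x 0F 1F (λ ()) ◅ ε
    within-outlet x 1F = edge x 1F 0F (λ ()) ◅ ε
    within-outlet x 2F = edge x 2F 0F (λ ()) ◅ ε

    climb : ∀ n → Star (Adj S) (inlet (origin , 0F)) (inlet (iter n (_⊕ 1) origin , 0F))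
    climb zero    = ε
    climb (suc n) = climb n ◅◅ within-outlet _ 0F ◅◅ inj₂ refl ◅ ε

    reach : ∀ x → Star (Adj S) (inlet (origin , 0F)) (inlet (x , 0F))
    reach x = subst (λ x → Star (Adj S) _ (inlet (x , 0F)))
      (trans (iter-⊕ (toℕ x) 1 origin) (trans (cong (origin ⊕_) (*-identityʳ (toℕ x))) (origin-⊕ x)))
      (climb (toℕ x))

    path : ∀ p → Star (Adj S) (inlet (origin , 0F)) p
    path (inlet (x , i))  = reach x ◅◅ within-inlet x i
    path (outlet (x , i)) = reach x ◅◅ within-outlet x i

-- An automorphism of order 2m

HasOrder-resp-≅ : ∀ {G H} (ψ : G ≅ H) (φ : Aut G) {n} → HasOrder φ n →
                  HasOrder (≅-trans (≅-sym ψ) (≅-trans φ ψ)) n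
HasOrder-resp-≅ ψ φ {n} (period , minimal) =
    (λ y → trans (conjugate n y) (trans (cong (apply ψ) (period _)) (apply-unapply ψ y)))
  , λ k 0<k k<n → let (x , moved) = minimal k 0<k k<n in
      apply ψ x , λ e → moved (apply-injective ψ (trans (sym (conjugate′ k x)) e))
  where
  φ′ = ≅-trans (≅-sym ψ) (≅-trans φ ψ)

  conjugate′ : ∀ k x → iter k (apply φ′) (apply ψ x) ≡ apply ψ (iter k (apply φ) x)
  conjugate′ zero    x = refl
  conjugate′ (suc k) x = trans (cong (apply φ′) (conjugate′ k x)) (cong (apply ψ ∘ apply φ) (unapply-apply ψ _))

  conjugate : ∀ k y → iter k (apply φ′) y ≡ apply ψ (iter k (apply φ) (unapply ψ y))
  conjugate k y = trans (cong (iter k (apply φ′)) (sym (apply-unapply ψ y))) (conjugate′ k (unapply ψ y))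

transpose : Fin 3 → Fin 3
transpose 0F = 0F
transpose 1F = 2F
transpose 2F = 1F

transpose-involutive : ∀ i → transpose (transpose i) ≡ i
transpose-involutive 0F = refl
transpose-involutive 1F = refl
transpose-involutive 2F = refl

iter-transpose-even : ∀ k i → iter (k * 2) transpose i ≡ i
iter-transpose-even zero    i = refl
iter-transpose-even (suc k) i = trans (transpose-involutive _) (iter-transpose-even k i)

iter-transpose-0F : ∀ k → iter k transpose 0F ≡ 0F
iter-transpose-0F zero    = refl
iter-transpose-0F (suc k) = cong transpose (iter-transpose-0F k)

odd⇒suc-even : ∀ {m} → ¬ (2 ∣ m) → ∃ λ c → m ≡ suc (c * 2)
odd⇒suc-even {m} odd with even⊎odd m
... | c , inj₁ e = ⊥-elim (odd (divides c e))
... | c , inj₂ e = c , e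

module _ {m : ℕ} .{{_ : NonZero m}} (odd : ¬ (2 ∣ m)) where

  private
    origin : Fin m
    origin = 0 mod m

  -- A rotation by one layer has order m, and swapping two strands has order 2. The two commute, so
  -- for odd m their product has order 2m.
  screw : Aut (Strand (proj₁ {B = λ (_ : Fin m) → Fin 3}) next)
  screw = shift 1 (pred m * 1) (negate-≈ m 1) transpose transpose transpose-involutive transpose-involutive

  move : Fin m × Fin 3 → Fin m × Fin 3
  move (x , i) = x ⊕ 1 , transpose i

  iter-move : ∀ k x i → iter k move (x , i) ≡ (x ⊕ k , iter k transpose i)
  iter-move k x i = trans (step k) (cong (_, iter k transpose i)
    (trans (iter-⊕ k 1 x) (cong (x ⊕_) (*-identityʳ k))))
    where
    step : ∀ k → iter k move (x , i) ≡ (iter k (_⊕ 1) x , iter k transpose i)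
    step zero    = refl
    step (suc k) = cong move (step k)

  iter-inlet : ∀ k z → iter k (apply screw) (inlet z) ≡ inlet (iter k move z)
  iter-inlet zero    z = refl
  iter-inlet (suc k) z = cong (apply screw) (iter-inlet k z)

  iter-outlet : ∀ k z → iter k (apply screw) (outlet z) ≡ outlet (iter k move z)
  iter-outlet zero    z = refl
  iter-outlet (suc k) z = cong (apply screw) (iter-outlet k z)

  screw-order : HasOrder screw (2 * m)
  screw-order =
      (λ { (inlet z)  → trans (iter-inlet (2 * m) z) (cong inlet (period z))
         ; (outlet z) → trans (iter-outlet (2 * m) z) (cong outlet (period z)) })
    , λ k 0<k k<2m → minimal k 0<k k<2m (k ≟ m)
    where
    inlet-injective : ∀ {z w : Fin m × Fin 3} → inlet z ≡ inlet w → z ≡ w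
    inlet-injective refl = refl

    period : ∀ z → iter (2 * m) move z ≡ z
    period (x , i) = trans (iter-move (2 * m) x i) (cong₂ _,_ (⊕-≈0 x (multiple≈0 2))
      (trans (cong (λ k → iter k transpose i) (*-comm 2 m)) (iter-transpose-even m i)))

    minimal : ∀ k → 0 < k → k < 2 * m → Dec (k ≡ m) →
              Σ (Port (Fin m × Fin 3)) λ p → ¬ (iter k (apply screw) p ≡ p)
    -- Below 2m the only positive multiple of m is m itself, so for any other k the layer of the
    -- origin changes.
    minimal k 0<k k<2m (no k≢m) = inlet (origin , 0F) , λ e → k≢m (multiple k<2m 0<k (≈0⇒∣ (⊕-fixed origin
      (cong proj₁ (trans (sym (iter-move k origin 0F)) (inlet-injective (trans (sym (iter-inlet k (origin , 0F))) e)))))))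
      where
      multiple : ∀ {k} → k < 2 * m → 0 < k → m ∣ k → k ≡ m
      multiple _ () (divides zero refl)
      multiple _ _ (divides 1 refl) = *-identityˡ m
      multiple k<2m _ (divides (suc (suc c)) refl) = ⊥-elim (<⇒≱ k<2m (*-monoˡ-≤ m (s≤s (s≤s (z≤n {c})))))
    -- After m steps the layer is back, but an odd number of transpositions has moved strand `1F`.
    minimal k _ _ (yes refl) = inlet (origin , 1F) , λ e → moved (odd⇒suc-even odd) (cong proj₂
      (trans (sym (iter-move k origin 1F)) (inlet-injective (trans (sym (iter-inlet k (origin , 1F))) e))))
      where
      moved : (∃ λ c → k ≡ suc (c * 2)) → iter k transpose 1F ≢ 1F
      moved (c , k≡) e with trans (sym (cong transpose (iter-transpose-even c 1F)))
                                  (trans (cong (λ k → iter k transpose 1F) (sym k≡)) e)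
      ... | ()

-- Untwisted strands

module _ {m : ℕ} .{{_ : NonZero m}} where

  private instance
    2m≢0 : NonZero (2 * m)
    2m≢0 = m*n≢0 2 m

  -- The layers are renumbered in the order in which a strand visits them: `Q x` is xq modulo m,
  -- with inverse `R` given by t. Strand `0F` becomes the a,b-strand; `1F` starts at `inj₂` of 0 and
  -- follows `P`, and `2F` runs opposite to it, shifted by m.
  SDW-≅-Strand : ∀ {q} t → t * q ≈ 1 [ m ] → 2 ∣ q → SDW m 3 ≅ Strand layer (turn {m} q)
  SDW-≅-Strand {q} t tq≈1 (divides c q≡c*2) = ≅-trans (≅-sym Strand-≅-SDW)
    (Strand-≅ f g f-g g-f f-next
      (λ {z} {w} e → trans (layer-f z) (trans (cong Q e) (sym (layer-f w))))
      (λ {z} {w} e → Q-injective (trans (sym (layer-f z)) (trans e (layer-f w)))))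
    where
    P : Fin m → Fin (2 * m)
    P x = (toℕ x * q) mod (2 * m)

    Q R : Fin m → Fin m
    Q x = (toℕ x * q) mod m
    R x = (toℕ x * t) mod m

    scale : ∀ x k → toℕ ((toℕ {m} x * k) mod m) ≈ k * toℕ x [ m ]
    scale x k = ≈-trans (mod-≈ (toℕ x * k)) (≈-reflexive (*-comm (toℕ x) k))

    cancel-tq : ∀ i → t * (q * i) ≈ i [ m ]
    cancel-tq i = ≈-trans (≈-reflexive (shuffle t q i)) (≈-trans (*-congˡ-≈ i tq≈1) (≈-reflexive (*-identityʳ i)))
      where
      shuffle : ∀ t q i → t * (q * i) ≡ i * (t * q)
      shuffle = solve-∀

    R-Q : ∀ x → R (Q x) ≡ x
    R-Q x = toℕ≈⇒≡ (≈-trans (scale (Q x) t) (≈-trans (*-congˡ-≈ t (scale x q)) (cancel-tq (toℕ x))))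

    Q-R : ∀ x → Q (R x) ≡ x
    Q-R x = toℕ≈⇒≡ (≈-trans (scale (R x) q) (≈-trans (*-congˡ-≈ q (scale x t))
      (≈-trans (≈-reflexive (shuffle q t (toℕ x))) (cancel-tq (toℕ x)))))
      where
      shuffle : ∀ q t i → q * (t * i) ≡ t * (q * i)
      shuffle = solve-∀

    Q-injective : ∀ {x y} → Q x ≡ Q y → x ≡ y
    Q-injective {x} {y} e = trans (sym (R-Q x)) (trans (cong R e) (R-Q y))

    red-P : ∀ x → red (P x) ≡ Q x
    red-P x = toℕ≈⇒≡ (≈-trans (toℕ-red (P x)) (≈-trans (≈-weaken 2 (mod-≈ (toℕ x * q))) (≈-sym (mod-≈ (toℕ x * q)))))

    -- Evenness of q enters here: a multiple of m times q is a multiple of 2m, so `P` still advances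
    -- by q when x wraps around.
    even-≈ : ∀ {i j} → i ≈ j [ m ] → i * q ≈ j * q [ 2 * m ]
    even-≈ {i} {j} (congruent k l e) = congruent (k * c) (l * c)
      (trans (cong (λ q → i * q + k * c * (2 * m)) q≡c*2) (trans (shuffle i k c m)
      (trans (cong (_* (c * 2)) e) (trans (sym (shuffle j l c m))
      (cong (λ q → j * q + l * c * (2 * m)) (sym q≡c*2))))))
      where
      shuffle : ∀ i k c m → i * (c * 2) + k * c * (2 * m) ≡ (i + k * m) * (c * 2)
      shuffle = solve-∀

    P-⊕ : ∀ x → P (x ⊕ 1) ≡ P x ⊕ q
    P-⊕ x = toℕ≈⇒≡ (≈-trans (mod-≈ (toℕ (x ⊕ 1) * q)) (≈-trans (even-≈ (toℕ-⊕ x 1))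
      (≈-trans (≈-reflexive (shuffle (toℕ x) q))
      (≈-trans (+-cong-≈ (≈-sym (mod-≈ (toℕ x * q))) (≈-refl {i = q})) (≈-sym (toℕ-⊕ (P x) q))))))
      where
      shuffle : ∀ x q → (x + 1) * q ≡ x * q + q
      shuffle = solve-∀

    Q-⊕ : ∀ x → Q (x ⊕ 1) ≡ Q x ⊕ q
    Q-⊕ x = trans (sym (red-P (x ⊕ 1))) (trans (cong red (P-⊕ x)) (trans (red-⊕ (P x) q) (cong (_⊕ q) (red-P x))))

    f : Fin m × Fin 3 → Pos
    f (x , 0F) = inj₁ (Q x)
    f (x , 1F) = inj₂ (P x)
    f (x , 2F) = inj₂ (P x ⊕ m)

    -- The two lifts of a layer are `P` and its shift by m; comparing i with the first tells the
    -- strand.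
    g₂ : ∀ i → Dec (i ≡ P (R (red i))) → Fin m × Fin 3
    g₂ i (yes _) = R (red i) , 1F
    g₂ i (no _)  = R (red i) , 2F

    g : Pos → Fin m × Fin 3
    g (inj₁ i) = R i , 0F
    g (inj₂ i) = g₂ i (i Fin.≟ P (R (red i)))

    f-g₂ : ∀ i d → f (g₂ i d) ≡ inj₂ i
    f-g₂ i (yes e) = cong inj₂ (sym e)
    f-g₂ i (no ne) = cong inj₂ (sym (red-fibre (trans (red-P (R (red i))) (Q-R (red i))) ne))

    f-g : ∀ y → f (g y) ≡ y
    f-g (inj₁ i) = cong inj₁ (Q-R i)
    f-g (inj₂ i) = f-g₂ i (i Fin.≟ P (R (red i)))

    layer-f : ∀ z → layer (f z) ≡ Q (proj₁ z)
    layer-f (x , 0F) = refl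
    layer-f (x , 1F) = red-P x
    layer-f (x , 2F) = trans (red-⊕m (P x)) (red-P x)

    same-strand : ∀ x i j → f (x , i) ≡ f (x , j) → i ≡ j
    same-strand x 0F 0F _ = refl
    same-strand x 1F 1F _ = refl
    same-strand x 2F 2F _ = refl
    same-strand x 1F 2F e = ⊥-elim (⊕m-free (P x) (sym (inj₂-injective e)))
    same-strand x 2F 1F e = ⊥-elim (⊕m-free (P x) (inj₂-injective e))
    same-strand x 0F 1F ()
    same-strand x 0F 2F ()
    same-strand x 1F 0F ()
    same-strand x 2F 0F ()

    f-injective : ∀ z w → proj₁ z ≡ proj₁ w → f z ≡ f w → z ≡ w
    f-injective (x , i) (.x , j) refl e = cong (x ,_) (same-strand x i j e)

    -- Since f is injective within a layer and both sides lie in the same one, `f-g` suffices.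
    g-f : ∀ z → g (f z) ≡ z
    g-f z = f-injective _ _ (Q-injective (trans (sym (layer-f (g (f z)))) (trans (cong layer (f-g (f z))) (layer-f z)))) (f-g (f z))

    f-next : ∀ z → f (next z) ≡ turn q (f z)
    f-next (x , 0F) = cong inj₁ (Q-⊕ x)
    f-next (x , 1F) = cong inj₂ (P-⊕ x)
    f-next (x , 2F) = cong inj₂ (trans (cong (_⊕ m) (P-⊕ x)) (⊕-swap (P x) q m))

-- The classification and its converse

module _ {m : ℕ} .{{_ : NonZero m}} where

  -- If q and m were both even, then so would be 1, the difference of tq and a multiple of m.
  unit-even⇒odd : ∀ {q} t → t * q ≈ 1 [ m ] → 2 ∣ q → ¬ (2 ∣ m)
  unit-even⇒odd t (congruent k l e) 2∣q 2∣m = absurd (∣m+n∣m⇒∣n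
    (subst (2 ∣_) (trans e (+-comm 1 (l * m))) (∣m∣n⇒∣m+n (∣n⇒∣m*n t 2∣q) (∣n⇒∣m*n k 2∣m))) (∣n⇒∣m*n l 2∣m))
    where
    absurd : ¬ (2 ∣ 1)
    absurd 2∣1 = <⇒≱ (s≤s (s≤s z≤n)) (∣⇒≤ 2∣1)

  -- With r′ for -r, the reflected graph has parameters r′ and s + r′. This shows that they fall
  -- under the case required by `Γ₁₂-≅-Strand`.
  reflected-s : ∀ r s → s ≈ r + r [ m ] → (s + pred (2 * m) * r) + pred (2 * m) * r ≈ 0 [ m ]
  reflected-s r s e = ≈-trans (≈-reflexive (+-assoc s r′ r′)) (≈-trans (+-cong-≈ e (≈-refl {i = r′ + r′}))
    (≈-trans (≈-reflexive (shuffle r r′)) (+-cong-≈ r+r′≈0 r+r′≈0)))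
    where
    r′ = pred (2 * m) * r
    r+r′≈0 : r + r′ ≈ 0 [ m ]
    r+r′≈0 = ≈-weaken 2 (negate-≈ (2 * m) {{m*n≢0 2 m}} r)
    shuffle : ∀ r r′ → r + r + (r′ + r′) ≡ (r + r′) + (r + r′)
    shuffle = solve-∀

  Γ₁₂-reflected : ∀ r s → Γ₁₂ m r s ≅ Γ₁₂ m (pred (2 * m) * r) (s + pred (2 * m) * r)
  Γ₁₂-reflected r s = Γ₁₂-reflect (negate-≈ (2 * m) {{m*n≢0 2 m}} r) ≈-refl

  classify₀ : ∀ {r s} → 3 < m → s + r ≈ 0 [ m ] → Connected (Γ₁₂ m r s) → VertexTransitive (Γ₁₂ m r s) →
              ¬ (2 ∣ m) × (Γ₁₂ m r s ≅ SDW m 3)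
  classify₀ {r} {s} 3<m s+r≈0 conn vt = conclude (connected⇒unit (connected-resp-≅ ψ conn))
    where
    ψ = Γ₁₂-≅-Strand s+r≈0
    conclude : (∃ λ t → t * (r + m) ≈ 1 [ m ]) → ¬ (2 ∣ m) × (Γ₁₂ m r s ≅ SDW m 3)
    conclude (t , tq≈1) = unit-even⇒odd t tq≈1 2∣q , ≅-trans ψ (≅-sym (SDW-≅-Strand t tq≈1 2∣q))
      where
      2∣q : 2 ∣ r + m
      2∣q = transitive⇒2∣ t tq≈1 3<m (transitive-resp-≅ ψ vt)

  classify : ∀ {r s} → 3 < m → Connected (Γ₁₂ m r s) → VertexTransitive (Γ₁₂ m r s) →
             ¬ (2 ∣ m) × (Γ₁₂ m r s ≅ SDW m 3)
  classify {r} {s} 3<m conn vt = cases (transitive⇒s vt)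
    where
    ρ = Γ₁₂-reflected r s
    cases : s + r ≈ 0 [ m ] ⊎ s ≈ r + r [ m ] → ¬ (2 ∣ m) × (Γ₁₂ m r s ≅ SDW m 3)
    cases (inj₁ e) = classify₀ 3<m e conn vt
    cases (inj₂ e) = Product.map₂ (≅-trans ρ)
      (classify₀ 3<m (reflected-s r s e) (connected-resp-≅ ρ conn) (transitive-resp-≅ ρ vt))

  -- The parameters 1 and 2 belong to the case s = 2r. Reflection replaces r by 2m - 1, so the
  -- advance q is 3m - 1, which is even for odd m and is -1 modulo m.
  SDW-≅-Γ₁₂ : ¬ (2 ∣ m) → SDW m 3 ≅ Γ₁₂ m 1 2
  SDW-≅-Γ₁₂ odd = ≅-trans (SDW-≅-Strand (pred m) tq≈1 2∣q)
    (≅-trans (≅-sym (Γ₁₂-≅-Strand (reflected-s 1 2 ≈-refl))) (≅-sym (Γ₁₂-reflected 1 2)))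
    where
    r′ = pred (2 * m) * 1
    q  = r′ + m

    1+r′≡2m : 1 + r′ ≡ 2 * m
    1+r′≡2m = trans (cong suc (*-identityʳ (pred (2 * m)))) (suc-pred (2 * m) {{m*n≢0 2 m}})

    1+q≈0 : 1 + q ≈ 0 [ m ]
    1+q≈0 = ≈-trans (≈-reflexive (trans (cong (_+ m) 1+r′≡2m) (+-comm (2 * m) m))) (multiple≈0 3)

    -- As q is -1 modulo m, it is its own inverse, represented by m - 1.
    tq≈1 : pred m * q ≈ 1 [ m ]
    tq≈1 = +-cancelˡ-≈ q (≈-trans (negate-≈ m q) (≈-trans (≈-sym 1+q≈0) (≈-reflexive (+-comm 1 q))))

    2∣q : 2 ∣ q
    2∣q = even (odd⇒suc-even odd)
      where
      even : (∃ λ c → m ≡ suc (c * 2)) → 2 ∣ q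
      -- 2 + q is the sum of the even numbers 2m and m + 1.
      even (c , e) = ∣m+n∣m⇒∣n {m = 2} (subst (2 ∣_) (trans (cong₂ _+_ (sym 1+r′≡2m) (cong suc (sym e))) (shuffle r′ m))
        (∣m∣n⇒∣m+n (divides m (*-comm 2 m)) (divides (suc c) refl))) (divides 1 refl)
        where
        shuffle : ∀ r m → (1 + r) + (1 + m) ≡ 2 + (r + m)
        shuffle = solve-∀

theorem6p12 : (m r s : ℕ) .{{_ : NonZero m}} → 3 < m → 0 < r → 0 < s → ¬ (2 * m ∣ r) →
    ((Connected (Γ₁₂ m r s) × VertexTransitive (Γ₁₂ m r s)) →
    (¬ (2 ∣ m)) × (Γ₁₂ m r s ≅ SDW m 3))
    × (¬ (2 ∣ m) →
    (SDW m 3 ≅ Γ₁₂ m 1 2) × Connected (SDW m 3) × VertexTransitive (SDW m 3)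
    × Σ (Aut (SDW m 3)) (λ φ → HasOrder φ (2 * m)))
theorem6p12 m r s 3<m _ _ _ =
    (λ (conn , vt) → classify 3<m conn vt)
  , λ odd → SDW-≅-Γ₁₂ odd , SDW-connected , SDW-transitive
          , ≅-trans (≅-sym Strand-≅-SDW) (≅-trans (screw odd) Strand-≅-SDW)
          , HasOrder-resp-≅ Strand-≅-SDW (screw odd) (screw-order odd)
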